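{- Fix an integer $m \geq 2$. Then for all sufficiently large $n$ the following holds. If $G$ is a properly edge-coloured graph on $n$ vertices with at least $n (\log n)^{60}$ edges, then $G$ contains a rainbow subdivision of $K_m$ in which each edge of $K_m$ is subdivided at most $(\log n)^{6}$ times.
   Context: Logarithms are in base 2. A proper edge-colouring assigns colours to edges so that edges sharing a vertex receive distinct colours. A subgraph is rainbow if all its edges have distinct colours. A subdivision of $K_m$ is a graph obtained from $K_m$ by replacing each edge by a path between its endpoints, these paths being internally vertex-disjoint; an edge is subdivided at most $t$ times if the corresponding path has at most $t$ internal vertices. -}

module Defs where

open import Data.Nat using (ℕ; _+_; _*_; _^_; _≤_; _<_; _<?_)
open import Data.Bool using (Bool; true; false; T)
open import Data.Bool.Properties using (T?)
open import Data.Fin using (Fin; toℕ)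
open import Data.List using (List; []; _∷_; _++_; length; map; filter; concatMap; allFin; cartesianProduct)
open import Data.List.Relation.Unary.All using (All)
open import Data.List.Relation.Unary.Unique.Propositional using (Unique)
open import Data.List.Relation.Unary.Linked using (Linked)
open import Data.Product using (_×_; _,_; Σ; proj₁; proj₂)
open import Relation.Nullary using (¬_)
open import Relation.Nullary.Decidable using (_×-dec_)
open import Relation.Binary.PropositionalEquality using (_≡_; _≢_)

record Graph (n : ℕ) : Set where
  field
    adj   : Fin n → Fin n → Bool
    sym   : ∀ u v → adj u v ≡ adj v u
    irrefl : ∀ v → adj v v ≡ false
open Graph public

Adj : ∀ {n} → Graph n → Fin n → Fin n → Set
Adj G u v = T (adj G u v)

ordPairs : (k : ℕ) → List (Fin k × Fin k)
ordPairs k = filter (λ p → toℕ (proj₁ p) <? toℕ (proj₂ p)) (cartesianProduct (allFin k) (allFin k))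

edges : ∀ {n} → Graph n → List (Fin n × Fin n)
edges {n} G = filter (λ p → (toℕ (proj₁ p) <? toℕ (proj₂ p)) ×-dec T? (adj G (proj₁ p) (proj₂ p)))
                     (cartesianProduct (allFin n) (allFin n))

numEdges : ∀ {n} → Graph n → ℕ
numEdges G = length (edges G)

-- An edge colouring (colours are natural numbers); only values on edges matter.
Colouring : ℕ → Set
Colouring n = Fin n → Fin n → ℕ

IsProperColouring : ∀ {n} → Graph n → Colouring n → Set
IsProperColouring G c =
  (∀ u v → Adj G u v → c u v ≡ c v u) ×
  (∀ u v w → Adj G u v → Adj G u w → v ≢ w → c u v ≢ c u w)

pathColours : ∀ {n} → Colouring n → List (Fin n) → List ℕ
pathColours c []            = []
pathColours c (x ∷ [])      = []
pathColours c (x ∷ y ∷ xs)  = c x y ∷ pathColours c (y ∷ xs)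

-- e ≥ n · (log₂ n)^60, stated exactly without reals:
-- for every rational a/b < log₂ n (i.e. 2^a < n^b), (a/b)^60 ≤ e/n.
AtLeastNLog60 : ℕ → ℕ → Set
AtLeastNLog60 n e = ∀ a b → 0 < b → 2 ^ a < n ^ b → a ^ 60 * n ≤ e * b ^ 60

-- t ≤ (log₂ n)^6, stated exactly without reals:
-- for every rational a/b > log₂ n (i.e. n^b < 2^a), t ≤ (a/b)^6.
AtMostLog6 : ℕ → ℕ → Set
AtMostLog6 n t = ∀ a b → 0 < b → n ^ b < 2 ^ a → t * b ^ 6 ≤ a ^ 6

-- A rainbow subdivision of K_m in G (w.r.t. colouring c) in which every edge of K_m
-- is subdivided at most (log₂ n)^6 times.
-- branch : branch vertices; path i j : the internal vertices of the path replacing ij (i < j).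
record RainbowSubdivision {n : ℕ} (m : ℕ) (G : Graph n) (c : Colouring n) : Set where
  field
    branch : Fin m → Fin n
    path   : Fin m → Fin m → List (Fin n)
  fullPath : Fin m × Fin m → List (Fin n)
  fullPath (i , j) = branch i ∷ (path i j ++ branch j ∷ [])
  field
    isPath   : All (λ p → Linked (Adj G) (fullPath p)) (ordPairs m)
    short    : All (λ p → AtMostLog6 n (length (path (proj₁ p) (proj₂ p)))) (ordPairs m)
    disjoint : Unique (map branch (allFin m) ++ concatMap (λ p → path (proj₁ p) (proj₂ p)) (ordPairs m))
    rainbow  : Unique (concatMap (λ p → pathColours c (fullPath p)) (ordPairs m))

{-# OPTIONS --safe #-}
-- The graph contains an expander of large minimum degree, where the size of a
-- vertex set is measured by its volume (the sum of its degrees).  From a vertex u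
-- grow a set of vertices reached by rainbow paths, in rounds: a round fixes a set
-- A of colours and extends the paths by one edge with colour in A.  Only few edges
-- at each reached vertex are unusable, so by expansion a round can multiply the
-- volume by 1 + Ω(1 / log n), and O(log² n) rounds reach more than two thirds of
-- the total volume.
--
-- To join u to v by one rainbow path, first grow from v, which assigns to most
-- vertices w a rainbow path Q w.  Then grow from u, choosing colours greedily so
-- that the gain in volume is large compared with the cost, the volume of those w
-- for which Q w uses the colour.  As each Q w is short the costs of all colours
-- add up to little, so the total cost stays below a third of the volume; hence
-- some w is reached from both sides by paths with no common colour.  The argument
-- tolerates few forbidden vertices and colours, so the pairs of branch vertices
-- are joined one after the other.
module Submission where

open import Defs renaming (sym to adj-symm)
open import Data.Bool using (Bool; true; false; not; _∧_; _∨_; T; if_then_else_)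
import Data.Bool as Bool
open import Data.Bool.Properties using (∧-comm; T-≡; T?)
open import Data.Fin using (Fin; zero; suc; toℕ; fromℕ<; inject≤)
import Data.Fin.Properties as Fin
open import Data.Fin.Subset.Properties using (anySubset?)
open import Data.List using (List; []; _∷_; _++_; length; map; filter; concat; concatMap; allFin; cartesianProduct; tabulate; lookup)
import Data.List.Membership.DecPropositional as DecMembership
open import Data.List.Membership.Propositional using (_∈_; _∉_)
open import Data.List.Membership.Propositional.Properties using (∈-++⁺ˡ; ∈-++⁺ʳ; ∈-++⁻; ∈-map⁺; ∈-allFin; ∈-filter⁻; ∈-lookup)
open import Data.List.Properties using (map-++; length-++; length-map; length-tabulate; map-tabulate; map-cong-local; filter-++)
open import Data.List.Relation.Binary.Subset.Propositional using (_⊆_)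
open import Data.List.Relation.Unary.All as All using (All; []; _∷_)
import Data.List.Relation.Unary.All.Properties as All
open import Data.List.Relation.Unary.AllPairs using ([]; _∷_)
open import Data.List.Relation.Unary.Any using (here; there)
open import Data.List.Relation.Unary.Linked as Linked using (Linked; [-]; _∷_)
open import Data.List.Relation.Unary.Unique.Propositional using (Unique)
import Data.List.Relation.Unary.Unique.Propositional.Properties as Unique
open import Data.Nat
import Data.Nat.ListAction as ListAction
import Data.Nat.ListAction.Properties as ListAction
open import Data.Nat.Properties
open import Data.Nat.Tactic.RingSolver using (solve-∀)
open import Data.Product using (_×_; _,_; ∃; Σ; proj₁; proj₂)
open import Data.Product.Properties using (≡-dec)
open import Data.Sum using (_⊎_; inj₁; inj₂)
import Data.Vec as Vec
open import Data.Vec.Properties using (lookup∘tabulate)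
open import Function using (_∘_; id; Equivalence)
open import Relation.Binary.Definitions using (DecidableEquality)
open import Relation.Binary.PropositionalEquality hiding (J)
open import Relation.Nullary using (Dec; yes; no; does; ¬_; contradiction)
open import Relation.Nullary.Decidable using (dec-true; dec-false; _×-dec_)
open import Relation.Unary using (Decidable)
import Algebra.Properties.Semiring.Sum +-*-semiring as Sum
open DecMembership _≟_ using (_∈?_)

-- The obstacle is that a vertex `w` receives only one path from each side, so a clash of colours at
-- `w` cannot be repaired there. The growth from `u` is therefore charged for its whole palette: `w`
-- counts as lost as soon as `Q w` meets the palette, whichever colours its own path uses. The
-- minimum degree `δ` works twice. It absorbs the unusable edges at a vertex, and it makes colours
-- profitable: each reached vertex adds at least `δ` to the volume, while the costs of all colours
-- together are at most `k` times the total. A good ratio of cost to gain does not control the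
-- colour with which a round passes its target. So a colour that alone costs more than `tot / e` is
-- excluded beforehand; by Markov's inequality this spoils at most `e * k` edges at a vertex. A
-- round then costs at most `2 * tot / e`, and `e = 6 * k` keeps `k` rounds within a third of the
-- total. A third is what two balls of more than two thirds must share. Hence expansion is needed
-- for sets up to two thirds of the volume, and a sparse cut leaves a part with at most two thirds
-- of the degree sum, which is where the logarithm to base 3/2 comes from.

private
  module FinMembership {n : ℕ} = DecMembership (Fin._≟_ {n})

-- Sums of natural numbers over Fin n

⟦_⟧ : Bool → ℕ
⟦ true ⟧  = 1
⟦ false ⟧ = 0

⟦⟧≤1 : ∀ b → ⟦ b ⟧ ≤ 1
⟦⟧≤1 true  = ≤-refl
⟦⟧≤1 false = z≤n

⟦⟧-∧ : ∀ a b → ⟦ a ∧ b ⟧ ≡ ⟦ a ⟧ * ⟦ b ⟧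
⟦⟧-∧ true  b = sym (*-identityˡ ⟦ b ⟧)
⟦⟧-∧ false b = refl

⟦⟧-∨ : ∀ a b → ⟦ a ∨ b ⟧ ≤ ⟦ a ⟧ + ⟦ b ⟧
⟦⟧-∨ true  b = s≤s z≤n
⟦⟧-∨ false b = ≤-refl

⟦⟧-pos : ∀ {b} → 0 < ⟦ b ⟧ → b ≡ true
⟦⟧-pos {true} _ = refl

opaque
  ∑ : ∀ {n} → (Fin n → ℕ) → ℕ
  ∑ = Sum.sum

  ∑-cong : ∀ {n} {f g : Fin n → ℕ} → (∀ i → f i ≡ g i) → ∑ f ≡ ∑ g
  ∑-cong = Sum.sum-cong-≗

  ∑-+ : ∀ {n} (f g : Fin n → ℕ) → ∑ (λ i → f i + g i) ≡ ∑ f + ∑ g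
  ∑-+ = Sum.∑-distrib-+

  ∑-swap : ∀ {m n} (f : Fin m → Fin n → ℕ) → ∑ (λ i → ∑ (f i)) ≡ ∑ (λ j → ∑ (λ i → f i j))
  ∑-swap = Sum.∑-comm

  *-∑ : ∀ {n} x (f : Fin n → ℕ) → x * ∑ f ≡ ∑ (λ i → x * f i)
  *-∑ = Sum.*-distribˡ-sum

  ∑-mono : ∀ {n} {f g : Fin n → ℕ} → (∀ i → f i ≤ g i) → ∑ f ≤ ∑ g
  ∑-mono {zero}  _   = z≤n
  ∑-mono {suc n} f≤g = +-mono-≤ (f≤g zero) (∑-mono (f≤g ∘ suc))

  term≤∑ : ∀ {n} (f : Fin n → ℕ) i → f i ≤ ∑ f
  term≤∑ f zero    = m≤m+n _ _
  term≤∑ f (suc i) = ≤-trans (term≤∑ (f ∘ suc) i) (m≤n+m _ (f zero))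

  ∑<⇒∃< : ∀ {n} {f g : Fin n → ℕ} → ∑ f < ∑ g → ∃ λ i → f i < g i
  ∑<⇒∃< {suc n} {f} {g} lt with f zero <? g zero
  ... | yes p = zero , p
  ... | no ¬p with ∑<⇒∃< {n} {f ∘ suc} {g ∘ suc} (+-cancelˡ-< (f zero) _ _ (<-≤-trans lt (+-monoˡ-≤ _ (≮⇒≥ ¬p))))
  ... | i , q = suc i , q

  ∑-zero : ∀ {n} {f : Fin n → ℕ} → (∀ i → f i ≡ 0) → ∑ f ≡ 0
  ∑-zero {zero}  _ = refl
  ∑-zero {suc n} h = cong₂ _+_ (h zero) (∑-zero (h ∘ suc))

  ∑-const : ∀ n x → ∑ {n} (λ _ → x) ≡ n * x
  ∑-const zero    x = refl
  ∑-const (suc n) x = cong (x +_) (∑-const n x)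

  ∑-suc : ∀ {n} (f : Fin (suc n) → ℕ) → ∑ f ≡ f zero + ∑ (f ∘ suc)
  ∑-suc f = refl

∑-pos : ∀ {n} {f : Fin n → ℕ} → 0 < ∑ f → ∃ λ i → 0 < f i
∑-pos {n} {f} lt = ∑<⇒∃< (subst (_< ∑ f) (sym (∑-zero {n} {λ _ → 0} λ _ → refl)) lt)

∑-* : ∀ {n} x (f : Fin n → ℕ) → ∑ f * x ≡ ∑ (λ i → f i * x)
∑-* x f = trans (*-comm (∑ f) x) (trans (*-∑ x f) (∑-cong λ i → *-comm x (f i)))

∑-indicator : ∀ {n} (x : Fin n) → ∑ (λ y → ⟦ does (y Fin.≟ x) ⟧) ≡ 1
∑-indicator {suc n} zero = trans (∑-suc _) (cong suc (∑-zero λ i → refl))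
∑-indicator {suc n} (suc x) = trans (∑-suc _) (trans (∑-cong λ y → cong ⟦_⟧ (does-suc y)) (∑-indicator x))
  where
  does-suc : ∀ y → does (Fin.suc y Fin.≟ suc x) ≡ does (y Fin.≟ x)
  does-suc y with y Fin.≟ x
  ... | yes _ = refl
  ... | no _  = refl

∑-atMostOne : ∀ {n} (g : Fin n → Bool) → (∀ y z → g y ≡ true → g z ≡ true → y ≡ z) → ∑ (λ y → ⟦ g y ⟧) ≤ 1
∑-atMostOne {n} g h with 0 <? ∑ (λ y → ⟦ g y ⟧)
... | no ¬p = ≤-trans (≮⇒≥ ¬p) z≤n
... | yes p with ∑-pos p
... | x , q = ≤-trans (∑-mono concentrated) (≤-reflexive (∑-indicator x))
  where
  concentrated : ∀ y → ⟦ g y ⟧ ≤ ⟦ does (y Fin.≟ x) ⟧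
  concentrated y with g y in eq | y Fin.≟ x
  ... | false | _ = z≤n
  ... | true | yes _ = ≤-refl
  ... | true | no ¬e with ¬e (h y x eq (⟦⟧-pos q))
  ... | ()

module _ {A : Set} (_≟A_ : DecidableEquality A) where
  open DecMembership _≟A_ using () renaming (_∈?_ to _∈A?_)

  -- In each use `g` is the indicator of a set on which the labels `f` are injective, so each list
  -- entry accounts for at most one point. It serves both for vertices in a list and for colours at
  -- a vertex.
  ∑-member≤length : ∀ {n} (g : Fin n → ℕ) (f : Fin n → A) (F : List A) →
    (∀ a → ∑ (λ y → g y * ⟦ does (f y ≟A a) ⟧) ≤ 1) →
    ∑ (λ y → g y * ⟦ does (f y ∈A? F) ⟧) ≤ length F
  ∑-member≤length g f []      h = ≤-reflexive (∑-zero λ y → *-zeroʳ (g y))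
  ∑-member≤length g f (a ∷ F) h = begin
    ∑ (λ y → g y * ⟦ does (f y ∈A? (a ∷ F)) ⟧)
      ≤⟨ ∑-mono (λ y → ≤-trans (*-monoʳ-≤ (g y) (⟦⟧-∨ (does (f y ≟A a)) _)) (≤-reflexive (*-distribˡ-+ (g y) _ _))) ⟩
    ∑ (λ y → g y * ⟦ does (f y ≟A a) ⟧ + g y * ⟦ does (f y ∈A? F) ⟧)
      ≡⟨ ∑-+ _ _ ⟩
    ∑ (λ y → g y * ⟦ does (f y ≟A a) ⟧) + ∑ (λ y → g y * ⟦ does (f y ∈A? F) ⟧)
      ≤⟨ +-mono-≤ (h a) (∑-member≤length g f F h) ⟩
    suc (length F) ∎
    where open ≤-Reasoning

-- Choosing the colours of one round

does-true : ∀ {P : Set} (d : Dec P) → does d ≡ true → P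
does-true (yes p) _ = p

positive⇒0< : ∀ {m} → (0 <ᵇ m) ≡ true → 0 < m
positive⇒0< {suc m} _ = z<s

<*⇒0<ˡ : ∀ m {l x} → x < m * l → 0 < m
<*⇒0<ˡ (suc m) _ = z<s

<*⇒0<ʳ : ∀ m {l x} → x < m * l → 0 < l
<*⇒0<ʳ m {zero} {x} p = contradiction (subst (x <_) (*-zeroʳ m) p) λ ()
<*⇒0<ʳ m {suc l} _ = z<s

0<⟦⟧* : ∀ b {m} → 0 < ⟦ b ⟧ * m → b ≡ true × 0 < m
0<⟦⟧* true {m} p = refl , subst (0 <_) (*-identityˡ m) p

module _ {n : ℕ} (E : Fin n → Fin n → Bool) where

  deg : Fin n → ℕ
  deg x = ∑ λ y → ⟦ E x y ⟧

  vol : (Fin n → Bool) → ℕ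
  vol S = ∑ λ x → ⟦ S x ⟧ * deg x

  tot : ℕ
  tot = ∑ deg

  cut : (Fin n → Bool) → ℕ
  cut S = ∑ λ x → ⟦ S x ⟧ * ∑ λ y → ⟦ not (S y) ⟧ * ⟦ E x y ⟧

  record ProperOn (c : Fin n → Fin n → ℕ) : Set where
    field
      symm     : ∀ x y → E x y ≡ E y x
      c-symm   : ∀ x y → E x y ≡ true → c x y ≡ c y x
      c-proper : ∀ x y z → E x y ≡ true → E x z ≡ true → c x y ≡ c x z → y ≡ z

  -- `minDeg` speaks of non-isolated vertices because the vertex set always remains `Fin n`:
  -- vertices outside a subgraph stay as isolated ones.
  record Expander (r δ : ℕ) : Set where
    field
      nonempty : 0 < tot
      minDeg   : ∀ x → 0 < deg x → δ ≤ deg x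
      expands  : ∀ S → 3 * vol S ≤ 2 * tot → vol S ≤ r * cut S

  edge⇒deg : ∀ x y → E x y ≡ true → 0 < deg x
  edge⇒deg x y e = <-≤-trans (subst (λ b → 0 < ⟦ b ⟧) (sym e) z<s) (term≤∑ (λ y → ⟦ E x y ⟧) y)

  vol≤tot : ∀ S → vol S ≤ tot
  vol≤tot S = ∑-mono λ x → ≤-trans (*-monoˡ-≤ (deg x) (⟦⟧≤1 (S x))) (≤-reflexive (*-identityˡ (deg x)))

  module _ (Q : Fin n → List ℕ) where

    cost : ℕ → ℕ
    cost α = ∑ λ w → deg w * ⟦ does (α ∈? Q w) ⟧

    costs : List ℕ → ℕ
    costs A = ListAction.sum (map cost A)

    -- Exchange the sums: `w` is charged its degree once for each colour of `Q w`, hence at most `k`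
    -- times.
    ∑-cost : ∀ C k → (∀ w → length (Q w) ≤ k) → ∑ {C} (cost ∘ toℕ) ≤ k * tot
    ∑-cost C k Q≤k = begin
      ∑ {C} (λ α → ∑ λ w → deg w * ⟦ does (toℕ α ∈? Q w) ⟧) ≡⟨ ∑-swap _ ⟩
      ∑ (λ w → ∑ {C} λ α → deg w * ⟦ does (toℕ α ∈? Q w) ⟧) ≤⟨ ∑-mono (λ w → perVertex w) ⟩
      ∑ (λ w → k * deg w)                                   ≡⟨ *-∑ k deg ⟨
      k * tot                                               ∎
      where
      open ≤-Reasoning
      once : ∀ a → ∑ {C} (λ α → 1 * ⟦ does (toℕ α ≟ a) ⟧) ≤ 1
      once a = ≤-trans (≤-reflexive (∑-cong λ α → *-identityˡ _))
        (∑-atMostOne _ λ y z p q → Fin.toℕ-injective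
          (trans (does-true (toℕ y ≟ a) p) (sym (does-true (toℕ z ≟ a) q))))
      perVertex : ∀ w → ∑ {C} (λ α → deg w * ⟦ does (toℕ α ∈? Q w) ⟧) ≤ k * deg w
      perVertex w = begin
        ∑ {C} (λ α → deg w * ⟦ does (toℕ α ∈? Q w) ⟧)         ≡⟨ *-∑ (deg w) _ ⟨
        deg w * ∑ {C} (λ α → ⟦ does (toℕ α ∈? Q w) ⟧)         ≡⟨ cong (deg w *_) (∑-cong λ α → sym (*-identityˡ _)) ⟩
        deg w * ∑ {C} (λ α → 1 * ⟦ does (toℕ α ∈? Q w) ⟧)     ≤⟨ *-monoʳ-≤ (deg w) (∑-member≤length _≟_ (λ _ → 1) toℕ (Q w) once) ⟩
        deg w * length (Q w)                                  ≤⟨ *-monoʳ-≤ (deg w) (Q≤k w) ⟩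
        deg w * k                                             ≡⟨ *-comm (deg w) k ⟩
        k * deg w                                             ∎

-- a x y says that the edge xy may be used to leave the current ball, v is the
-- volume of that ball.
module Round {n : ℕ} (E : Fin n → Fin n → Bool) (c : Fin n → Fin n → ℕ) (pr : ProperOn E c)
  (δ : ℕ) (minDeg : ∀ x → 0 < deg E x → δ ≤ deg E x)
  (C : ℕ) (c<C : ∀ x y → c x y < C)
  (Q : Fin n → List ℕ) (k : ℕ) (Q≤k : ∀ w → length (Q w) ≤ k)
  (tot>0 : 0 < tot E)
  (e : ℕ) (e>0 : 0 < e) (eq≤δ : e * suc k ≤ δ)
  (a : Fin n → Fin n → Bool) (a⊆E : ∀ x y → a x y ≡ true → E x y ≡ true)
  (cheap : ∀ x y → a x y ≡ true → e * cost E Q (c x y) ≤ tot E)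
  (v R : ℕ) (v>0 : 0 < v) (v≤ : v ≤ R * ∑ (λ x → ∑ λ y → ⟦ a x y ⟧))
  where

  open ProperOn pr

  indeg : Fin n → ℕ
  indeg y = ∑ λ x → ⟦ a x y ⟧

  -- The number of α-coloured pairs into y; properness makes it 0 or 1.
  hit : ℕ → Fin n → ℕ
  hit α y = ∑ λ x → ⟦ a x y ∧ does (c x y ≟ α) ⟧

  hit⇒edge : ∀ α y → 0 < hit α y → ∃ λ x → a x y ≡ true × c x y ≡ α
  hit⇒edge α y h with ∑-pos h
  ... | x , p with a x y in eq
  ... | true = x , eq , does-true (c x y ≟ α) (⟦⟧-pos p)

  hit≤1 : ∀ α y → hit α y ≤ 1
  hit≤1 α y = ∑-atMostOne _ uniq
    where
    split : ∀ x → a x y ∧ does (c x y ≟ α) ≡ true → E y x ≡ true × c y x ≡ α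
    split x p with a x y in eq
    ... | true with does-true (c x y ≟ α) p
    ... | refl = trans (symm y x) (a⊆E x y eq) , sym (c-symm x y (a⊆E x y eq))
    uniq : ∀ x z → a x y ∧ does (c x y ≟ α) ≡ true → a z y ∧ does (c z y ≟ α) ≡ true → x ≡ z
    uniq x z p q with split x p | split z q
    ... | e₁ , r₁ | e₂ , r₂ = c-proper y x z e₁ e₂ (trans r₁ (sym r₂))

  -- As `hit` is 0 or 1, this is the volume that `α` would add to `Y`. Keeping the count makes it
  -- linear, so that summing over colours recovers in-degrees.
  gain : (Fin n → Bool) → ℕ → ℕ
  gain Y α = ∑ λ y → (deg E y * ⟦ not (Y y) ⟧) * hit α y

  extend : (Fin n → Bool) → ℕ → Fin n → Bool
  extend Y α y = Y y ∨ (0 <ᵇ hit α y)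

  vol-extend : ∀ Y α → vol E Y + gain Y α ≤ vol E (extend Y α)
  vol-extend Y α = ≤-trans (≤-reflexive (sym (∑-+ _ _))) (∑-mono pointwise)
    where
    pointwise : ∀ y → ⟦ Y y ⟧ * deg E y + (deg E y * ⟦ not (Y y) ⟧) * hit α y ≤ ⟦ extend Y α y ⟧ * deg E y
    pointwise y with Y y
    ... | true = ≤-reflexive (trans (cong (λ z → 1 * deg E y + z * hit α y) (*-zeroʳ (deg E y))) (+-identityʳ _))
    ... | false with hit α y | hit≤1 α y
    ... | zero  | _ = ≤-reflexive (*-zeroʳ (deg E y * 1))
    ... | suc m | m≤1 = ≤-trans (*-monoʳ-≤ (deg E y * 1) m≤1) (≤-reflexive (arith (deg E y)))
      where
      arith : ∀ d → d * 1 * 1 ≡ 1 * d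
      arith = solve-∀

  unreached : (Fin n → Bool) → ℕ
  unreached Y = ∑ λ y → ⟦ not (Y y) ⟧ * indeg y

  indeg≤deg : ∀ y → indeg y ≤ deg E y
  indeg≤deg y = ∑-mono pointwise
    where
    pointwise : ∀ x → ⟦ a x y ⟧ ≤ ⟦ E y x ⟧
    pointwise x with a x y in eq
    ... | false = z≤n
    ... | true rewrite trans (symm y x) (a⊆E x y eq) = ≤-refl

  v≤unreached+vol : ∀ Y → v ≤ R * (unreached Y + vol E Y)
  v≤unreached+vol Y = ≤-trans v≤ (*-monoʳ-≤ R (begin
    ∑ (λ x → ∑ λ y → ⟦ a x y ⟧)                            ≡⟨ ∑-swap _ ⟩
    ∑ indeg                                                ≤⟨ ∑-mono pointwise ⟩
    ∑ (λ y → ⟦ not (Y y) ⟧ * indeg y + ⟦ Y y ⟧ * deg E y)  ≡⟨ ∑-+ _ _ ⟩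
    unreached Y + vol E Y                                  ∎))
    where
    open ≤-Reasoning
    pointwise : ∀ y → indeg y ≤ ⟦ not (Y y) ⟧ * indeg y + ⟦ Y y ⟧ * deg E y
    pointwise y with Y y
    ... | true  = ≤-trans (indeg≤deg y) (≤-reflexive (sym (*-identityˡ _)))
    ... | false = ≤-reflexive (sym (trans (+-identityʳ _) (*-identityˡ _)))

  -- Each usable pair into a vertex outside `Y` has a colour, and contributes to the gain of that
  -- colour the degree of the vertex, at least `δ`. The bound `C` makes the colours a finite range
  -- to sum over.
  δ*unreached≤∑gain : ∀ Y → δ * unreached Y ≤ ∑ {C} (gain Y ∘ toℕ)
  δ*unreached≤∑gain Y = begin
    δ * unreached Y                                                        ≡⟨ *-∑ δ _ ⟩
    ∑ (λ y → δ * (⟦ not (Y y) ⟧ * indeg y))                                ≤⟨ ∑-mono pointwise ⟩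
    ∑ (λ y → (deg E y * ⟦ not (Y y) ⟧) * ∑ {C} (λ α → hit (toℕ α) y))      ≡⟨ ∑-cong (λ y → *-∑ (deg E y * ⟦ not (Y y) ⟧) _) ⟩
    ∑ (λ y → ∑ {C} λ α → (deg E y * ⟦ not (Y y) ⟧) * hit (toℕ α) y)        ≡⟨ ∑-swap _ ⟩
    ∑ {C} (gain Y ∘ toℕ)                                                   ∎
    where
    open ≤-Reasoning
    everyColour : ∀ x y → ⟦ a x y ⟧ ≤ ∑ {C} (λ α → ⟦ a x y ∧ does (c x y ≟ toℕ α) ⟧)
    everyColour x y = ≤-trans same (term≤∑ _ (fromℕ< (c<C x y)))
      where
      same : ⟦ a x y ⟧ ≤ ⟦ a x y ∧ does (c x y ≟ toℕ (fromℕ< (c<C x y))) ⟧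
      same rewrite dec-true (c x y ≟ toℕ (fromℕ< (c<C x y))) (sym (Fin.toℕ-fromℕ< (c<C x y)))
        with a x y
      ... | true  = ≤-refl
      ... | false = z≤n
    indeg≤ : ∀ y → indeg y ≤ ∑ {C} (λ α → hit (toℕ α) y)
    indeg≤ y = ≤-trans (∑-mono λ x → everyColour x y) (≤-reflexive (∑-swap _))
    arith : ∀ d s t → d * (s * t) ≡ (d * s) * t
    arith = solve-∀
    pointwise : ∀ y → δ * (⟦ not (Y y) ⟧ * indeg y) ≤ (deg E y * ⟦ not (Y y) ⟧) * ∑ {C} (λ α → hit (toℕ α) y)
    pointwise y with 0 <? indeg y
    ... | no ¬p rewrite n≤0⇒n≡0 (≮⇒≥ ¬p) | *-zeroʳ ⟦ not (Y y) ⟧ | *-zeroʳ δ = z≤n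
    ... | yes p = begin
      δ * (⟦ not (Y y) ⟧ * indeg y)         ≡⟨ arith δ _ _ ⟩
      (δ * ⟦ not (Y y) ⟧) * indeg y         ≤⟨ *-mono-≤ (*-monoˡ-≤ ⟦ not (Y y) ⟧ (minDeg y (<-≤-trans p (indeg≤deg y)))) (indeg≤ y) ⟩
      (deg E y * ⟦ not (Y y) ⟧) * ∑ {C} (λ α → hit (toℕ α) y) ∎

  -- The usable pairs that end in `Y` number at most its volume, less than half of `v / R`; so at
  -- least half of `v / R` pairs end outside.
  v≤2R*unreached : ∀ Y → 2 * R * vol E Y < v → v ≤ 2 * R * unreached Y
  v≤2R*unreached Y lt = +-cancelʳ-≤ v v _ (begin
    v + v                                     ≤⟨ +-mono-≤ (v≤unreached+vol Y) (v≤unreached+vol Y) ⟩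
    R * (u + w) + R * (u + w)                 ≡⟨ arith R u w ⟩
    2 * R * u + 2 * R * w                     ≤⟨ +-monoʳ-≤ (2 * R * u) (<⇒≤ lt) ⟩
    2 * R * u + v                             ∎)
    where
    open ≤-Reasoning
    u = unreached Y
    w = vol E Y
    arith : ∀ R u w → R * (u + w) + R * (u + w) ≡ 2 * R * u + 2 * R * w
    arith = solve-∀

  -- On average a colour costs at most k * tot / ∑gain per unit of gain.
  goodColour : ∀ Y → 2 * R * vol E Y < v →
    ∃ λ α → 0 < gain Y α × cost E Q α * (δ * v) ≤ 2 * R * (gain Y α * (suc k * tot E))
  goodColour Y lt with ∑<⇒∃< {C} {λ α → cost E Q (toℕ α) * B} {λ α → gain Y (toℕ α) * (suc k * tot E)} average
    where
    B = ∑ {C} (gain Y ∘ toℕ)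
    open ≤-Reasoning
    0<u : 0 < unreached Y
    0<u = <*⇒0<ʳ (2 * R) (<-≤-trans v>0 (v≤2R*unreached Y lt))
    0<δ : 0 < δ
    0<δ = <-≤-trans (*-mono-≤ e>0 (s≤s z≤n)) eq≤δ
    0<B : 0 < B
    0<B = <-≤-trans (*-mono-≤ 0<δ 0<u) (δ*unreached≤∑gain Y)
    average : ∑ {C} (λ α → cost E Q (toℕ α) * B) < ∑ {C} (λ α → gain Y (toℕ α) * (suc k * tot E))
    average = begin-strict
      ∑ {C} (λ α → cost E Q (toℕ α) * B)                   ≡⟨ ∑-* B _ ⟨
      ∑ {C} (cost E Q ∘ toℕ) * B                           ≤⟨ *-monoˡ-≤ B (∑-cost E Q C k Q≤k) ⟩
      -- `suc k` in place of `k` leaves a spare summand, so the inequality is strict even when every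
      -- cost vanishes; strictness forces a positive gain.
      k * tot E * B                                        <⟨ m<n+m (k * tot E * B) (*-mono-≤ tot>0 0<B) ⟩
      tot E * B + k * tot E * B                            ≡⟨ *-distribʳ-+ B (tot E) (k * tot E) ⟨
      suc k * tot E * B                                    ≡⟨ *-comm (suc k * tot E) B ⟩
      B * (suc k * tot E)                                  ≡⟨ ∑-* (suc k * tot E) _ ⟩
      ∑ {C} (λ α → gain Y (toℕ α) * (suc k * tot E))       ∎
  ... | α′ , p = α , 0<gain , (begin
    cost E Q α * (δ * v)                     ≤⟨ *-monoʳ-≤ (cost E Q α) δv≤ ⟩
    cost E Q α * (2 * R * B)                 ≡⟨ arith (cost E Q α) (2 * R) B ⟩
    2 * R * (cost E Q α * B)                 ≤⟨ *-monoʳ-≤ (2 * R) (<⇒≤ p) ⟩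
    2 * R * (gain Y α * (suc k * tot E))     ∎)
    where
    open ≤-Reasoning
    α = toℕ α′
    B = ∑ {C} (gain Y ∘ toℕ)
    0<gain : 0 < gain Y α
    0<gain = <*⇒0<ˡ (gain Y α) p
    arith : ∀ x r b → x * (r * b) ≡ r * (x * b)
    arith = solve-∀
    δv≤ : δ * v ≤ 2 * R * B
    δv≤ = begin
      δ * v                         ≤⟨ *-monoʳ-≤ δ (v≤2R*unreached Y lt) ⟩
      δ * (2 * R * unreached Y)     ≡⟨ arith δ (2 * R) _ ⟩
      2 * R * (δ * unreached Y)     ≤⟨ *-monoʳ-≤ (2 * R) (δ*unreached≤∑gain Y) ⟩
      2 * R * B                     ∎

  gain⇒cheap : ∀ Y α → 0 < gain Y α → e * cost E Q α ≤ tot E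
  gain⇒cheap Y α p with ∑-pos p
  ... | y , q with hit⇒edge α y (<*⇒0<ʳ (deg E y * ⟦ not (Y y) ⟧) q)
  ... | x , ax , refl = cheap x y ax

  record Reached : Set where
    field
      new      : Fin n → Bool
      palette  : List ℕ
      large    : v ≤ 2 * R * vol E new
      parent   : ∀ y → new y ≡ true → ∃ λ x → a x y ≡ true × c x y ∈ palette
      costs≤   : e * costs E Q palette ≤ 2 * tot E

  Covered : (Fin n → Bool) → List ℕ → Set
  Covered Y A = ∀ y → Y y ≡ true → ∃ λ x → a x y ≡ true × c x y ∈ A

  -- Cross-multiplied: the cost per unit of volume is at most `2 * R * suc k * tot E / (δ * v)`, the
  -- ratio that `goodColour` guarantees. It survives adding colours because both cost and volume add
  -- up.
  CheapCover : (Fin n → Bool) → List ℕ → Set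
  CheapCover Y A = costs E Q A * (δ * v) ≤ 2 * R * (vol E Y * (suc k * tot E))

  covered-extend : ∀ Y A α → Covered Y A → Covered (extend Y α) (α ∷ A)
  covered-extend Y A α par y p with Y y in eq
  ... | true  = let x , q , r = par y eq in x , q , there r
  ... | false = let x , q , r = hit⇒edge α y (positive⇒0< p) in x , q , here r

  cheap-extend : ∀ Y A α → cost E Q α * (δ * v) ≤ 2 * R * (gain Y α * (suc k * tot E)) →
                 CheapCover Y A → CheapCover (extend Y α) (α ∷ A)
  cheap-extend Y A α ratio inv = begin
    (cost E Q α + costs E Q A) * (δ * v)
      ≡⟨ *-distribʳ-+ (δ * v) (cost E Q α) _ ⟩
    cost E Q α * (δ * v) + costs E Q A * (δ * v)
      ≤⟨ +-mono-≤ ratio inv ⟩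
    2 * R * (gain Y α * (suc k * tot E)) + 2 * R * (vol E Y * (suc k * tot E))
      ≡⟨ arith (2 * R) (gain Y α) (vol E Y) (suc k * tot E) ⟩
    2 * R * ((vol E Y + gain Y α) * (suc k * tot E))
      ≤⟨ *-monoʳ-≤ (2 * R) (*-monoˡ-≤ (suc k * tot E) (vol-extend Y α)) ⟩
    2 * R * (vol E (extend Y α) * (suc k * tot E)) ∎
    where
    open ≤-Reasoning
    arith : ∀ r g y t → r * (g * t) + r * (y * t) ≡ r * ((y + g) * t)
    arith = solve-∀

  -- Below the target volume `v / (2 * R)` the ratio bounds the cost by `suc k * tot E / δ`, and
  -- `eq≤δ` makes this at most `tot E / e`.
  cheap-early : ∀ Y A → 2 * R * vol E Y < v → CheapCover Y A → e * costs E Q A ≤ tot E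
  cheap-early Y A lt inv = *-cancelʳ-≤ (e * costs E Q A) (tot E) (suc k * v)
    {{>-nonZero (*-mono-≤ {1} {suc k} (s≤s z≤n) v>0)}} (begin
      e * costs E Q A * (suc k * v)             ≡⟨ arith₁ e (suc k) (costs E Q A) v ⟩
      costs E Q A * (e * suc k * v)             ≤⟨ *-monoʳ-≤ (costs E Q A) (*-monoˡ-≤ v eq≤δ) ⟩
      costs E Q A * (δ * v)                     ≤⟨ inv ⟩
      2 * R * (vol E Y * (suc k * tot E))       ≡⟨ *-assoc (2 * R) (vol E Y) (suc k * tot E) ⟨
      2 * R * vol E Y * (suc k * tot E)         ≤⟨ *-monoˡ-≤ (suc k * tot E) (<⇒≤ lt) ⟩
      v * (suc k * tot E)                       ≡⟨ arith₃ v (suc k) (tot E) ⟩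
      tot E * (suc k * v)                       ∎)
    where
    open ≤-Reasoning
    arith₁ : ∀ e q x v → e * x * (q * v) ≡ x * (e * q * v)
    arith₁ = solve-∀
    arith₃ : ∀ v q t → v * (q * t) ≡ t * (q * v)
    arith₃ = solve-∀

  -- `fuel` bounds the volume by which `Y` falls short of `v`; each colour gains at least one unit.
  -- Stopping at the first passage of the target splits the cost into two parts of at most
  -- `tot E / e`: the earlier colours, by `cheap-early`, and the last one, by `gain⇒cheap`.
  grow : ∀ fuel Y A → v ≤ fuel + vol E Y → 2 * R * vol E Y < v → Covered Y A → CheapCover Y A → Reached
  grow zero Y A fuel lt par inv = contradiction (≤-<-trans (≤-trans fuel volY≤) lt) (<-irrefl refl)
    where
    volY≤ : vol E Y ≤ 2 * R * vol E Y
    volY≤ = ≤-trans (≤-reflexive (sym (*-identityˡ _))) (*-monoˡ-≤ (vol E Y) (*-mono-≤ {1} {2} (s≤s z≤n) (<*⇒0<ˡ R (<-≤-trans v>0 v≤))))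
  grow (suc fuel) Y A fuel≤ lt par inv =
    let α , 0<g , ratio = goodColour Y lt in continue α 0<g ratio (<-≤-connex (2 * R * vol E (extend Y α)) v)
    where
    continue : ∀ α → 0 < gain Y α → cost E Q α * (δ * v) ≤ 2 * R * (gain Y α * (suc k * tot E)) →
               2 * R * vol E (extend Y α) < v ⊎ v ≤ 2 * R * vol E (extend Y α) → Reached
    continue α 0<g ratio (inj₁ lt′) =
      grow fuel (extend Y α) (α ∷ A) fuel′ lt′ (covered-extend Y A α par) (cheap-extend Y A α ratio inv)
      where
      open ≤-Reasoning
      fuel′ : v ≤ fuel + vol E (extend Y α)
      fuel′ = begin
        v                                ≤⟨ fuel≤ ⟩
        suc (fuel + vol E Y)             ≡⟨ +-suc fuel (vol E Y) ⟨
        fuel + suc (vol E Y)             ≤⟨ +-monoʳ-≤ fuel (≤-trans (m<m+n (vol E Y) 0<g) (vol-extend Y α)) ⟩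
        fuel + vol E (extend Y α)        ∎
    continue α 0<g ratio (inj₂ ge) = record
      { new = extend Y α ; palette = α ∷ A ; large = ge ; parent = covered-extend Y A α par ; costs≤ = costs≤′ }
      where
      open ≤-Reasoning
      costs≤′ : e * costs E Q (α ∷ A) ≤ 2 * tot E
      costs≤′ = begin
        e * (cost E Q α + costs E Q A)        ≡⟨ *-distribˡ-+ e (cost E Q α) _ ⟩
        e * cost E Q α + e * costs E Q A      ≤⟨ +-mono-≤ (gain⇒cheap Y α 0<g) (cheap-early Y A lt inv) ⟩
        tot E + tot E                         ≡⟨ cong (tot E +_) (+-identityʳ (tot E)) ⟨
        2 * tot E                             ∎

  opaque
    reach : Reached
    reach = grow v (λ _ → false) [] (m≤m+n v _) (subst (_< v) (sym empty) v>0) (λ _ ()) z≤n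
      where
      empty : 2 * R * vol E (λ _ → false) ≡ 0
      empty = trans (cong (2 * R *_) (∑-zero λ _ → refl)) (*-zeroʳ (2 * R))

-- Growing a ball of rainbow trails

∧-true : ∀ {a b} → a ∧ b ≡ true → a ≡ true × b ≡ true
∧-true {true} p = refl , p

not-does : ∀ {P : Set} (d : Dec P) → not (does d) ≡ true → ¬ P
not-does (no ¬p) _ = ¬p

module _ {n : ℕ} (E : Fin n → Fin n → Bool) (c : Fin n → Fin n → ℕ) (pr : ProperOn E c) where
  open ProperOn pr

  colourDegree≤ : ∀ x (L : List ℕ) → ∑ (λ y → ⟦ E x y ⟧ * ⟦ does (c x y ∈? L) ⟧) ≤ length L
  colourDegree≤ x L = ∑-member≤length _≟_ (λ y → ⟦ E x y ⟧) (c x) L once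
    where
    once : ∀ a → ∑ (λ y → ⟦ E x y ⟧ * ⟦ does (c x y ≟ a) ⟧) ≤ 1
    once a = ≤-trans (≤-reflexive (∑-cong λ y → sym (⟦⟧-∧ (E x y) _))) (∑-atMostOne _ uniq)
      where
      uniq : ∀ y z → E x y ∧ does (c x y ≟ a) ≡ true → E x z ∧ does (c x z ≟ a) ≡ true → y ≡ z
      uniq y z p q with ∧-true {E x y} p | ∧-true {E x z} q
      ... | e₁ , r₁ | e₂ , r₂ = c-proper x y z e₁ e₂
        (trans (does-true (c x y ≟ a) r₁) (sym (does-true (c x z ≟ a) r₂)))

  -- Markov's inequality: at `x` a colour occurs on at most one edge, so each `w` is charged at most
  -- `k` times and the costs of the edges at `x` sum to at most `k * tot E`.
  expensiveDegree≤ : ∀ (Q : Fin n → List ℕ) k → (∀ w → length (Q w) ≤ k) → 0 < tot E → ∀ e x →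
    ∑ (λ y → ⟦ E x y ⟧ * ⟦ not (does (e * cost E Q (c x y) ≤? tot E)) ⟧) ≤ e * k
  expensiveDegree≤ Q k Q≤k tot>0 e x = *-cancelʳ-≤ _ (e * k) (tot E) {{>-nonZero tot>0}} (begin
    ∑ (λ y → ⟦ E x y ⟧ * ⟦ not (does (e * cost E Q (c x y) ≤? tot E)) ⟧) * tot E  ≡⟨ ∑-* (tot E) _ ⟩
    ∑ (λ y → ⟦ E x y ⟧ * ⟦ not (does (e * cost E Q (c x y) ≤? tot E)) ⟧ * tot E)  ≤⟨ ∑-mono markov ⟩
    ∑ (λ y → e * ∑ λ w → ⟦ E x y ⟧ * (deg E w * ⟦ does (c x y ∈? Q w) ⟧))        ≡⟨ *-∑ e _ ⟨
    e * ∑ (λ y → ∑ λ w → ⟦ E x y ⟧ * (deg E w * ⟦ does (c x y ∈? Q w) ⟧))        ≡⟨ cong (e *_) (∑-swap _) ⟩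
    e * ∑ (λ w → ∑ λ y → ⟦ E x y ⟧ * (deg E w * ⟦ does (c x y ∈? Q w) ⟧))        ≤⟨ *-monoʳ-≤ e (∑-mono perVertex) ⟩
    e * ∑ (λ w → k * deg E w)                                                    ≡⟨ cong (e *_) (*-∑ k _) ⟨
    e * (k * tot E)                                                              ≡⟨ *-assoc e k (tot E) ⟨
    e * k * tot E                                                                ∎)
    where
    open ≤-Reasoning
    arith₁ : ∀ b e x → e * (b * x) ≡ b * (e * x)
    arith₁ = solve-∀
    arith₂ : ∀ b d m → b * (d * m) ≡ d * (b * m)
    arith₂ = solve-∀
    over : ∀ s → ⟦ not (does (s ≤? tot E)) ⟧ * tot E ≤ s
    over s with s ≤? tot E | dec-true (s ≤? tot E) | dec-false (s ≤? tot E)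
    ... | yes p | t | _ rewrite t p = z≤n
    ... | no ¬p | _ | f rewrite f ¬p = ≤-trans (≤-reflexive (*-identityˡ _)) (<⇒≤ (≰⇒> ¬p))
    markov : ∀ y → ⟦ E x y ⟧ * ⟦ not (does (e * cost E Q (c x y) ≤? tot E)) ⟧ * tot E ≤
                   e * ∑ (λ w → ⟦ E x y ⟧ * (deg E w * ⟦ does (c x y ∈? Q w) ⟧))
    markov y = begin
      ⟦ E x y ⟧ * ⟦ not (does (e * cost E Q (c x y) ≤? tot E)) ⟧ * tot E  ≡⟨ *-assoc ⟦ E x y ⟧ _ (tot E) ⟩
      ⟦ E x y ⟧ * (⟦ not (does (e * cost E Q (c x y) ≤? tot E)) ⟧ * tot E) ≤⟨ *-monoʳ-≤ ⟦ E x y ⟧ (over (e * cost E Q (c x y))) ⟩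
      ⟦ E x y ⟧ * (e * cost E Q (c x y))                                ≡⟨ arith₁ ⟦ E x y ⟧ e (cost E Q (c x y)) ⟨
      e * (⟦ E x y ⟧ * cost E Q (c x y))                                ≡⟨ cong (e *_) (*-∑ ⟦ E x y ⟧ _) ⟩
      e * ∑ (λ w → ⟦ E x y ⟧ * (deg E w * ⟦ does (c x y ∈? Q w) ⟧))      ∎
    perVertex : ∀ w → ∑ (λ y → ⟦ E x y ⟧ * (deg E w * ⟦ does (c x y ∈? Q w) ⟧)) ≤ k * deg E w
    perVertex w = begin
      ∑ (λ y → ⟦ E x y ⟧ * (deg E w * ⟦ does (c x y ∈? Q w) ⟧)) ≡⟨ ∑-cong (λ y → arith₂ ⟦ E x y ⟧ (deg E w) _) ⟩
      ∑ (λ y → deg E w * (⟦ E x y ⟧ * ⟦ does (c x y ∈? Q w) ⟧)) ≡⟨ *-∑ (deg E w) _ ⟨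
      deg E w * ∑ (λ y → ⟦ E x y ⟧ * ⟦ does (c x y ∈? Q w) ⟧)   ≤⟨ *-monoʳ-≤ (deg E w) (colourDegree≤ x (Q w)) ⟩
      deg E w * length (Q w)                                   ≤⟨ *-monoʳ-≤ (deg E w) (Q≤k w) ⟩
      deg E w * k                                              ≡⟨ *-comm (deg E w) k ⟩
      k * deg E w                                              ∎

  module _ (F : List (Fin n)) (Z : List ℕ) (root : Fin n) where

    -- Vertices may repeat; only colours must differ. This keeps the list of obstructions at a
    -- vertex short, and loops can be cut out later, which only discards colours. The root is exempt
    -- from avoiding `F`.
    data Trail : List ℕ → Fin n → Set where
      start : Trail [] root
      step  : ∀ {cs x} y → Trail cs x → E x y ≡ true → y ∉ F → c x y ∉ Z → c x y ∉ cs → Trail (c x y ∷ cs) y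

-- `robust` lets the expansion survive the unusable edges at the price of a factor 2; a second
-- factor 2 comes from the target of a round. So a round multiplies the volume by at least
-- `1 + 1 / (2 * (2 * r))`, and by `deep` this power exceeds the total volume after `k` rounds.
module Growth {n : ℕ} (E : Fin n → Fin n → Bool) (c : Fin n → Fin n → ℕ) (pr : ProperOn E c)
  (r δ : ℕ) (ex : Expander E r δ) (C : ℕ) (c<C : ∀ x y → c x y < C)
  (Q : Fin n → List ℕ) (k : ℕ) (Q≤k : ∀ w → length (Q w) ≤ k)
  (e : ℕ) (e>0 : 0 < e) (eq≤δ : e * suc k ≤ δ)
  (F : List (Fin n)) (Z : List ℕ)
  (robust : 2 * r * (length F + length Z + k + e * k) ≤ δ)
  (deep : tot E * (2 * (2 * r)) ^ k < (2 * (2 * r) + 1) ^ k)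
  (root : Fin n) (root>0 : 0 < deg E root)
  where

  open ProperOn pr
  open Expander ex renaming (nonempty to tot>0)

  s : ℕ
  s = length F + length Z + k + e * k

  module Alive (U : Fin n → Bool) (cs : Fin n → List ℕ) where

    affordable : ℕ → Bool
    affordable α = does (e * cost E Q α ≤? tot E)

    alive : Fin n → Fin n → Bool
    alive x y = U x ∧ (not (U y) ∧ (E x y ∧ (not (does (y FinMembership.∈? F)) ∧
      (not (does (c x y ∈? Z)) ∧ (not (does (c x y ∈? cs x)) ∧ affordable (c x y))))))

    record AliveEdge (x y : Fin n) : Set where
      field
        inside  : U x ≡ true
        outside : not (U y) ≡ true
        edge    : E x y ≡ true
        y∉F     : y ∉ F
        c∉Z     : c x y ∉ Z
        c∉cs    : c x y ∉ cs x
        cheap   : e * cost E Q (c x y) ≤ tot E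

    alive⇒edge : ∀ x y → alive x y ≡ true → AliveEdge x y
    alive⇒edge x y p =
      let p₁ , p  = ∧-true {U x} p
          p₂ , p  = ∧-true {not (U y)} p
          p₃ , p  = ∧-true {E x y} p
          p₄ , p  = ∧-true {not (does (y FinMembership.∈? F))} p
          p₅ , p  = ∧-true {not (does (c x y ∈? Z))} p
          p₆ , p₇ = ∧-true {not (does (c x y ∈? cs x))} p
      in record
        { inside = p₁ ; outside = p₂ ; edge = p₃ ; y∉F = not-does (y FinMembership.∈? F) p₄
        ; c∉Z = not-does (c x y ∈? Z) p₅ ; c∉cs = not-does (c x y ∈? cs x) p₆
        ; cheap = does-true (e * cost E Q (c x y) ≤? tot E) p₇ }

    aliveSum : ℕ
    aliveSum = ∑ λ x → ∑ λ y → ⟦ alive x y ⟧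

    dead : Fin n → Fin n → ℕ
    dead x y = 1 * ⟦ does (y FinMembership.∈? F) ⟧ + ⟦ E x y ⟧ * ⟦ does (c x y ∈? Z) ⟧
             + ⟦ E x y ⟧ * ⟦ does (c x y ∈? cs x) ⟧ + ⟦ E x y ⟧ * ⟦ not (affordable (c x y)) ⟧

    ∑-dead : ∀ x → length (cs x) ≤ k → ∑ (dead x) ≤ s
    ∑-dead x cs≤k = begin
      ∑ (dead x)
        ≡⟨ ∑-+ _ _ ⟩
      ∑ (λ y → 1 * ⟦ does (y FinMembership.∈? F) ⟧ + ⟦ E x y ⟧ * ⟦ does (c x y ∈? Z) ⟧ + ⟦ E x y ⟧ * ⟦ does (c x y ∈? cs x) ⟧) + d₄
        ≡⟨ cong (_+ d₄) (∑-+ _ _) ⟩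
      ∑ (λ y → 1 * ⟦ does (y FinMembership.∈? F) ⟧ + ⟦ E x y ⟧ * ⟦ does (c x y ∈? Z) ⟧) + d₃ + d₄
        ≡⟨ cong (λ t → t + d₃ + d₄) (∑-+ _ _) ⟩
      ∑ (λ y → 1 * ⟦ does (y FinMembership.∈? F) ⟧) + ∑ (λ y → ⟦ E x y ⟧ * ⟦ does (c x y ∈? Z) ⟧) + d₃ + d₄
        ≤⟨ +-mono-≤ (+-mono-≤ (+-mono-≤ (∑-member≤length Fin._≟_ (λ _ → 1) (λ y → y) F once) (colourDegree≤ E c pr x Z))
             (≤-trans (colourDegree≤ E c pr x (cs x)) cs≤k)) (expensiveDegree≤ E c pr Q k Q≤k tot>0 e x) ⟩
      s ∎
      where
      open ≤-Reasoning
      d₃ = ∑ (λ y → ⟦ E x y ⟧ * ⟦ does (c x y ∈? cs x) ⟧)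
      d₄ = ∑ (λ y → ⟦ E x y ⟧ * ⟦ not (affordable (c x y)) ⟧)
      once : ∀ z → ∑ (λ y → 1 * ⟦ does (y Fin.≟ z) ⟧) ≤ 1
      once z = ≤-reflexive (trans (∑-cong λ y → *-identityˡ _) (∑-indicator z))

    alive+dead : ∀ x y → ⟦ U x ⟧ * (⟦ not (U y) ⟧ * ⟦ E x y ⟧) ≤ ⟦ alive x y ⟧ + ⟦ U x ⟧ * dead x y
    alive+dead x y = boolean (U x) (not (U y)) (E x y) (does (y FinMembership.∈? F))
      (does (c x y ∈? Z)) (does (c x y ∈? cs x)) (affordable (c x y))
      where
      boolean : ∀ u v w f z q a → ⟦ u ⟧ * (⟦ v ⟧ * ⟦ w ⟧) ≤
        ⟦ u ∧ (v ∧ (w ∧ (not f ∧ (not z ∧ (not q ∧ a))))) ⟧ + ⟦ u ⟧ * (1 * ⟦ f ⟧ + ⟦ w ⟧ * ⟦ z ⟧ + ⟦ w ⟧ * ⟦ q ⟧ + ⟦ w ⟧ * ⟦ not a ⟧)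
      boolean false v     w     f     z     q     a     = z≤n
      boolean true  false w     f     z     q     a     = z≤n
      boolean true  true  false f     z     q     a     = z≤n
      boolean true  true  true  true  z     q     a     = s≤s z≤n
      boolean true  true  true  false true  q     a     = s≤s z≤n
      boolean true  true  true  false false true  a     = s≤s z≤n
      boolean true  true  true  false false false true  = s≤s z≤n
      boolean true  true  true  false false false false = s≤s z≤n

    module _ (inU : ∀ x → U x ≡ true → length (cs x) ≤ k × 0 < deg E x) where

      cut≤ : cut E U ≤ aliveSum + ∑ (λ x → ⟦ U x ⟧ * s)
      cut≤ = begin
        ∑ (λ x → ⟦ U x ⟧ * ∑ λ y → ⟦ not (U y) ⟧ * ⟦ E x y ⟧)       ≤⟨ ∑-mono pointwise ⟩
        ∑ (λ x → ∑ (λ y → ⟦ alive x y ⟧) + ⟦ U x ⟧ * s)             ≡⟨ ∑-+ _ _ ⟩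
        aliveSum + ∑ (λ x → ⟦ U x ⟧ * s)                           ∎
        where
        open ≤-Reasoning
        bound : ∀ x → ⟦ U x ⟧ * ∑ (dead x) ≤ ⟦ U x ⟧ * s
        bound x with U x in eq
        ... | false = z≤n
        ... | true  = *-monoʳ-≤ 1 (∑-dead x (proj₁ (inU x eq)))
        pointwise : ∀ x → ⟦ U x ⟧ * ∑ (λ y → ⟦ not (U y) ⟧ * ⟦ E x y ⟧) ≤ ∑ (λ y → ⟦ alive x y ⟧) + ⟦ U x ⟧ * s
        pointwise x = begin
          ⟦ U x ⟧ * ∑ (λ y → ⟦ not (U y) ⟧ * ⟦ E x y ⟧)          ≡⟨ *-∑ ⟦ U x ⟧ _ ⟩
          ∑ (λ y → ⟦ U x ⟧ * (⟦ not (U y) ⟧ * ⟦ E x y ⟧))        ≤⟨ ∑-mono (alive+dead x) ⟩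
          ∑ (λ y → ⟦ alive x y ⟧ + ⟦ U x ⟧ * dead x y)          ≡⟨ ∑-+ _ _ ⟩
          ∑ (λ y → ⟦ alive x y ⟧) + ∑ (λ y → ⟦ U x ⟧ * dead x y) ≡⟨ cong (∑ (λ y → ⟦ alive x y ⟧) +_) (*-∑ ⟦ U x ⟧ _) ⟨
          ∑ (λ y → ⟦ alive x y ⟧) + ⟦ U x ⟧ * ∑ (dead x)         ≤⟨ +-monoʳ-≤ _ (bound x) ⟩
          ∑ (λ y → ⟦ alive x y ⟧) + ⟦ U x ⟧ * s                 ∎

      -- Double the expansion inequality: the unusable edges, at most `s` at each vertex of `U`,
      -- contribute at most `2 * r * s ≤ δ` per vertex, thus one copy of `vol E U`, which cancels.
      vol≤aliveSum : 3 * vol E U ≤ 2 * tot E → vol E U ≤ 2 * r * aliveSum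
      vol≤aliveSum small = +-cancelʳ-≤ (vol E U) _ _ (begin
        vol E U + vol E U                                     ≤⟨ +-mono-≤ (expands U small) (expands U small) ⟩
        r * cut E U + r * cut E U                             ≡⟨ arith₁ r (cut E U) ⟩
        2 * r * cut E U                                       ≤⟨ *-monoʳ-≤ (2 * r) cut≤ ⟩
        2 * r * (aliveSum + ∑ (λ x → ⟦ U x ⟧ * s))            ≡⟨ *-distribˡ-+ (2 * r) aliveSum _ ⟩
        2 * r * aliveSum + 2 * r * ∑ (λ x → ⟦ U x ⟧ * s)      ≤⟨ +-monoʳ-≤ (2 * r * aliveSum) dead≤vol ⟩
        2 * r * aliveSum + vol E U                            ∎)
        where
        open ≤-Reasoning
        arith₁ : ∀ r c → r * c + r * c ≡ 2 * r * c
        arith₁ = solve-∀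
        arith₂ : ∀ r u s → r * (u * s) ≡ u * (r * s)
        arith₂ = solve-∀
        pointwise : ∀ x → 2 * r * (⟦ U x ⟧ * s) ≤ ⟦ U x ⟧ * deg E x
        pointwise x = ≤-trans (≤-reflexive (arith₂ (2 * r) ⟦ U x ⟧ s)) bound
          where
          bound : ⟦ U x ⟧ * (2 * r * s) ≤ ⟦ U x ⟧ * deg E x
          bound with U x in eq
          ... | false = z≤n
          ... | true  = *-monoʳ-≤ 1 (≤-trans robust (minDeg x (proj₂ (inU x eq))))
        dead≤vol : 2 * r * ∑ (λ x → ⟦ U x ⟧ * s) ≤ vol E U
        dead≤vol = ≤-trans (≤-reflexive (*-∑ (2 * r) _)) (∑-mono pointwise)

  -- The trails to different vertices are unrelated except that all colours come from one `palette`,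
  -- so a single cost bound serves them all. `large` is the growth factor raised to the number of
  -- rounds, cross-multiplied.
  record Ball (i : ℕ) : Set where
    field
      U       : Fin n → Bool
      cs      : Fin n → List ℕ
      palette : List ℕ
      root∈U  : U root ≡ true
      trail   : ∀ x → U x ≡ true → Trail E c pr F Z root (cs x) x
      cs≤     : ∀ x → U x ≡ true → length (cs x) ≤ i
      cs⊆     : ∀ x → U x ≡ true → ∀ {α} → α ∈ cs x → α ∈ palette
      deg>0   : ∀ x → U x ≡ true → 0 < deg E x
      costs≤  : e * costs E Q palette ≤ 2 * i * tot E
      large   : (2 * (2 * r) + 1) ^ i ≤ vol E U * (2 * (2 * r)) ^ i

  0<vol : ∀ U x → U x ≡ true → 0 < deg E x → 0 < vol E U
  0<vol U x p d = <-≤-trans (subst (λ b → 0 < ⟦ b ⟧ * deg E x) (sym p) (≤-trans d (≤-reflexive (sym (*-identityˡ _))))) (term≤∑ _ x)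

  costs-++ : ∀ A B → costs E Q (A ++ B) ≡ costs E Q A + costs E Q B
  costs-++ A B = trans (cong ListAction.sum (map-++ (cost E Q) A B)) (ListAction.sum-++ (map (cost E Q) A) (map (cost E Q) B))

  initial : Ball 0
  initial = record
    { U = U ; cs = λ _ → [] ; palette = [] ; root∈U = dec-true (root Fin.≟ root) refl
    ; trail = λ x p → subst (Trail E c pr F Z root []) (sym (does-true (x Fin.≟ root) p)) start
    ; cs≤ = λ _ _ → z≤n ; cs⊆ = λ _ _ () ; deg>0 = deg>0
    ; costs≤ = ≤-reflexive (*-zeroʳ e)
    ; large = ≤-trans (0<vol U root (dec-true (root Fin.≟ root) refl) root>0) (≤-reflexive (sym (*-identityʳ _))) }
    where
    U : Fin n → Bool
    U x = does (x Fin.≟ root)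
    deg>0 : ∀ x → U x ≡ true → 0 < deg E x
    deg>0 x p = subst (λ z → 0 < deg E z) (sym (does-true (x Fin.≟ root) p)) root>0

  module Extension (i : ℕ) (B : Ball i)
    (new : Fin n → Bool) (newPalette : List ℕ)
    (parent : ∀ y → new y ≡ true → ∃ λ x → Alive.alive (Ball.U B) (Ball.cs B) x y ≡ true × c x y ∈ newPalette)
    (new-large : vol E (Ball.U B) ≤ 2 * (2 * r) * vol E new)
    (new-costs≤ : e * costs E Q newPalette ≤ 2 * tot E)
    where
    open Ball B
    open Alive U cs
    open ≤-Reasoning

    U′ : Fin n → Bool
    U′ x = U x ∨ new x

    -- The parent of `y`, hence the colour list, depends on the proof that `y` is new; carrying the
    -- equation as an argument lets `newMember` refer to the same proof.
    newColours : ∀ y b → new y ≡ b → List ℕ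
    newColours y true  eq = let x , _ = parent y eq in c x y ∷ cs x
    newColours y false eq = []

    cs′ : Fin n → List ℕ
    cs′ y with U y
    ... | true  = cs y
    ... | false = newColours y (new y) refl

    record Member (x : Fin n) (ds : List ℕ) : Set where
      field
        trail : Trail E c pr F Z root ds x
        cs≤   : length ds ≤ suc i
        cs⊆   : ∀ {α} → α ∈ ds → α ∈ palette ++ newPalette
        deg>0 : 0 < deg E x

    newMember : ∀ y b (eq : new y ≡ b) → b ≡ true → Member y (newColours y b eq)
    newMember y true eq _ with parent y eq
    ... | x , ax , c∈ = record
      { trail = step y (trail x inside) edge y∉F c∉Z c∉cs
      ; cs≤ = s≤s (cs≤ x inside)
      ; cs⊆ = λ { (here refl) → ∈-++⁺ʳ palette c∈ ; (there p) → ∈-++⁺ˡ (cs⊆ x inside p) }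
      ; deg>0 = edge⇒deg E y x (trans (symm y x) edge) }
      where open AliveEdge (alive⇒edge x y ax)

    member : ∀ x → U′ x ≡ true → Member x (cs′ x)
    member x p with U x in eq
    ... | true  = record
      { trail = trail x eq ; cs≤ = m≤n⇒m≤1+n (cs≤ x eq) ; cs⊆ = λ q → ∈-++⁺ˡ (cs⊆ x eq q) ; deg>0 = deg>0 x eq }
    ... | false = newMember x (new x) refl p

    arith₁ : ∀ i t → 2 * i * t + 2 * t ≡ 2 * suc i * t
    arith₁ = solve-∀
    costs≤′ : e * costs E Q (palette ++ newPalette) ≤ 2 * suc i * tot E
    costs≤′ = begin
      e * costs E Q (palette ++ newPalette)                     ≡⟨ cong (e *_) (costs-++ palette newPalette) ⟩
      e * (costs E Q palette + costs E Q newPalette)            ≡⟨ *-distribˡ-+ e _ _ ⟩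
      e * costs E Q palette + e * costs E Q newPalette          ≤⟨ +-mono-≤ costs≤ new-costs≤ ⟩
      2 * i * tot E + 2 * tot E                                ≡⟨ arith₁ i (tot E) ⟩
      2 * suc i * tot E                                        ∎

    vol-∪ : vol E U + vol E new ≤ vol E U′
    vol-∪ = ≤-trans (≤-reflexive (sym (∑-+ _ _))) (∑-mono pointwise)
      where
      -- Alive edges leave `U`, so the new vertices are disjoint from it and the volumes add.
      disjoint : ∀ y → new y ≡ true → not (U y) ≡ true
      disjoint y eq = let x , ax , _ = parent y eq in AliveEdge.outside (alive⇒edge x y ax)
      pointwise : ∀ x → ⟦ U x ⟧ * deg E x + ⟦ new x ⟧ * deg E x ≤ ⟦ U′ x ⟧ * deg E x
      pointwise x with U x | new x | disjoint x
      ... | true  | true  | d = contradiction (d refl) λ ()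
      ... | true  | false | d = ≤-reflexive (+-identityʳ _)
      ... | false | b     | d = ≤-refl

    X : ℕ
    X = 2 * (2 * r)
    arith₂ : ∀ X u w → X * u * w + u * w ≡ (X + 1) * (u * w)
    arith₂ = solve-∀
    arith₃ : ∀ X u v w → X * u * w + X * v * w ≡ (u + v) * (X * w)
    arith₃ = solve-∀
    large′ : (X + 1) ^ suc i ≤ vol E U′ * X ^ suc i
    large′ = begin
      (X + 1) * (X + 1) ^ i                                    ≤⟨ *-monoʳ-≤ (X + 1) large ⟩
      (X + 1) * (vol E U * X ^ i)                              ≡⟨ arith₂ X (vol E U) (X ^ i) ⟨
      X * vol E U * X ^ i + vol E U * X ^ i                    ≤⟨ +-monoʳ-≤ (X * vol E U * X ^ i) (*-monoˡ-≤ (X ^ i) new-large) ⟩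
      X * vol E U * X ^ i + X * vol E new * X ^ i            ≡⟨ arith₃ X (vol E U) (vol E new) (X ^ i) ⟩
      (vol E U + vol E new) * (X * X ^ i)                    ≤⟨ *-monoˡ-≤ (X * X ^ i) vol-∪ ⟩
      vol E U′ * (X * X ^ i)                                   ∎

    ball : Ball (suc i)
    ball = record
      { U = U′ ; cs = cs′ ; palette = palette ++ newPalette
      ; root∈U = subst (λ b → b ∨ new root ≡ true) (sym root∈U) refl
      ; trail = λ x p → Member.trail (member x p)
      ; cs≤ = λ x p → Member.cs≤ (member x p)
      ; cs⊆ = λ x p → Member.cs⊆ (member x p)
      ; deg>0 = λ x p → Member.deg>0 (member x p)
      ; costs≤ = costs≤′ ; large = large′ }

  advance : ∀ i → i ≤ k → (B : Ball i) → 3 * vol E (Ball.U B) ≤ 2 * tot E → Ball (suc i)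
  advance i i≤k B small = Extension.ball i B R.new R.palette R.parent R.large R.costs≤
    where
    open Ball B
    open Alive U cs
    module R = Round.Reached (Round.reach E c pr δ minDeg C c<C Q k Q≤k tot>0 e e>0 eq≤δ alive
      (λ x y p → AliveEdge.edge (alive⇒edge x y p)) (λ x y p → AliveEdge.cheap (alive⇒edge x y p))
      (vol E U) (2 * r) (0<vol U root root∈U root>0)
      (vol≤aliveSum (λ x p → ≤-trans (cs≤ x p) i≤k , deg>0 x p) small))

  FinalBall : Set
  FinalBall = ∃ λ i → i ≤ k × Σ (Ball i) λ B → 2 * tot E < 3 * vol E (Ball.U B)

  iterate : ∀ j i → j + i ≡ k → Ball i → FinalBall
  decide : ∀ j i → j + i ≡ k → (B : Ball i) →
           2 * tot E < 3 * vol E (Ball.U B) ⊎ 3 * vol E (Ball.U B) ≤ 2 * tot E → FinalBall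
  iterate j i eq B = decide j i eq B (<-≤-connex (2 * tot E) (3 * vol E (Ball.U B)))
  decide j       i eq B (inj₁ big)     = i , m+n≤o⇒n≤o j (≤-reflexive eq) , B , big
  -- After `k` rounds the volume would exceed the total, contrary to `vol≤tot`; so some earlier ball
  -- was already big.
  decide zero    .k refl B (inj₂ small) = contradiction
    (≤-<-trans (Ball.large B) (≤-<-trans (*-monoˡ-≤ _ (vol≤tot E (Ball.U B))) deep)) (<-irrefl refl)
  decide (suc j) i eq B (inj₂ small) =
    iterate j (suc i) (trans (+-suc j i) eq) (advance i (m+n≤o⇒n≤o (suc j) (≤-reflexive eq)) B small)

  opaque
    finalBall : FinalBall
    finalBall = iterate k 0 (+-identityʳ k) initial

-- Connecting two vertices

module _ {n : ℕ} (E : Fin n → Fin n → Bool) (c : Fin n → Fin n → ℕ) (pr : ProperOn E c) where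
  open ProperOn pr

  Edge : Fin n → Fin n → Set
  Edge x y = E x y ≡ true

  -- Inductive rather than an equation with `_++_`, so that a suffix of a path inherits it by
  -- matching.
  data EndsAt (v : Fin n) : List (Fin n) → Set where
    stop : EndsAt v (v ∷ [])
    _∷_  : ∀ x {xs} → EndsAt v xs → EndsAt v (x ∷ xs)

  endsAt-∷ʳ : ∀ {v xs} → EndsAt v xs → ∃ λ is → xs ≡ is ++ v ∷ []
  endsAt-∷ʳ stop       = [] , refl
  endsAt-∷ʳ (x ∷ ends) with endsAt-∷ʳ ends
  ... | is , refl = x ∷ is , refl

  record RainbowPath (P : Fin n → Set) (Z : List ℕ) (v : Fin n) (xs : List (Fin n)) : Set where
    field
      ends    : EndsAt v xs
      linked  : Linked Edge xs
      unique  : Unique xs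
      rainbow : Unique (pathColours c xs)
      within  : All P xs
      avoids  : All (_∉ Z) (pathColours c xs)

  module _ {P : Fin n → Set} {Z : List ℕ} {v : Fin n} where

    cutAt : ∀ {p xs} → RainbowPath P Z v xs → p ∈ xs →
            ∃ λ zs → RainbowPath P Z v (p ∷ zs) × pathColours c (p ∷ zs) ⊆ pathColours c xs × length zs ≤ length xs
    cutAt {xs = x ∷ zs} path (here refl) = zs , path , id , n≤1+n _
    cutAt {xs = x ∷ y ∷ zs} path (there p∈) with cutAt {xs = y ∷ zs} tail p∈
      where
      open RainbowPath path
      tail-ends : ∀ {x y zs} → EndsAt v (x ∷ y ∷ zs) → EndsAt v (y ∷ zs)
      tail-ends (_ ∷ e) = e
      tail-unique : ∀ {A : Set} {x : A} {xs} → Unique (x ∷ xs) → Unique xs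
      tail-unique (_ ∷ u) = u
      tail-all : ∀ {A : Set} {R : A → Set} {x xs} → All R (x ∷ xs) → All R xs
      tail-all (_ ∷ u) = u
      tail : RainbowPath P Z v (y ∷ zs)
      tail = record
        { ends = tail-ends ends ; linked = Linked.tail linked ; unique = tail-unique unique
        ; rainbow = tail-unique rainbow ; within = tail-all within ; avoids = tail-all avoids }
    ... | ws , path′ , sub , len = ws , path′ , there ∘ sub , m≤n⇒m≤1+n len

    -- Loop erasure: if `p` already lies on the path, continue from its occurrence there instead of
    -- adding the edge.
    prepend : ∀ {p x zs} → RainbowPath P Z v (x ∷ zs) → Edge p x → P p →
      c p x ∉ pathColours c (x ∷ zs) → c p x ∉ Z →
      ∃ λ ws → RainbowPath P Z v (p ∷ ws) × pathColours c (p ∷ ws) ⊆ c p x ∷ pathColours c (x ∷ zs) × length ws ≤ suc (length zs)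
    prepend {p} {x} {zs} path edge Pp new c∉Z with p FinMembership.∈? (x ∷ zs)
    ... | yes p∈ = let ws , path′ , sub , len = cutAt path p∈ in ws , path′ , there ∘ sub , len
    ... | no p∉ = x ∷ zs , record
      { ends = p ∷ ends ; linked = edge ∷ linked ; unique = All.¬Any⇒All¬ _ p∉ ∷ unique
      ; rainbow = All.¬Any⇒All¬ _ new ∷ rainbow ; within = Pp ∷ within ; avoids = c∉Z ∷ avoids } , id , ≤-refl
      where open RainbowPath path

  module _ (F : List (Fin n)) (Z : List ℕ) (u v : Fin n) where

    -- When branch vertices are joined, `F` contains `u` and `v` too, but they must be allowed as
    -- endpoints. `link` recovers from uniqueness that interior vertices avoid `F`.
    Free : Fin n → Set
    Free y = y ≡ u ⊎ y ≡ v ⊎ y ∉ F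

    -- A trail from `v` is read backwards, from `w` to `v`; hence the symmetry of `E` and `c` at
    -- each step.
    fromTrail : ∀ {ds w} → Trail E c pr F Z v ds w →
      ∃ λ zs → RainbowPath Free Z v (w ∷ zs) × pathColours c (w ∷ zs) ⊆ ds × length zs ≤ length ds
    fromTrail start = [] , record
      { ends = stop ; linked = [-] ; unique = [] ∷ [] ; rainbow = [] ; within = inj₂ (inj₁ refl) ∷ [] ; avoids = [] }
      , (λ ()) , z≤n
    fromTrail (step {ds} {x} y trail edge y∉F c∉Z c∉ds) with fromTrail trail
    ... | zs , path , sub , len =
      let ws , path′ , sub′ , len′ = prepend path (trans (symm y x) edge) (inj₂ (inj₂ y∉F))
            (subst (_∉ pathColours c (x ∷ zs)) colour (c∉ds ∘ sub)) (subst (_∉ Z) colour c∉Z)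
      in ws , path′ , widen sub sub′ , ≤-trans len′ (s≤s len)
      where
      colour : c x y ≡ c y x
      colour = c-symm x y edge
      widen : ∀ {as bs} → bs ⊆ ds → as ⊆ c y x ∷ bs → as ⊆ c x y ∷ ds
      widen sub sub′ a with sub′ a
      ... | here refl = here (sym colour)
      ... | there b   = there (sub b)

    trail-free : ∀ {cs w} → Trail E c pr F Z u cs w → Free w
    trail-free start                  = inj₁ refl
    trail-free (step _ _ _ y∉F _ _)   = inj₂ (inj₂ y∉F)

    -- Undoing the last step of the trail prepends a vertex to the path. The colours stay disjoint
    -- from those still to come because the trail is rainbow.
    follow : ∀ {cs w zs} → Trail E c pr F Z u cs w → RainbowPath Free Z v (w ∷ zs) →
      (∀ {α} → α ∈ pathColours c (w ∷ zs) → α ∉ cs) →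
      ∃ λ ws → RainbowPath Free Z v (u ∷ ws) × length ws ≤ length cs + length zs
    follow {zs = zs} start path disj = zs , path , ≤-refl
    follow {zs = zs} (step {cs} {p} w trail edge w∉F c∉Z c∉cs) path disj =
      let ws , path′ , sub , len = prepend path edge (trail-free trail) (λ q → disj q (here refl)) c∉Z
          ws′ , path″ , len′ = follow trail path′ (disjoint sub)
      in ws′ , path″ , ≤-trans len′ (≤-trans (+-monoʳ-≤ (length cs) len) (≤-reflexive (+-suc (length cs) (length zs))))
      where
      disjoint : ∀ {as} → as ⊆ c p w ∷ pathColours c (w ∷ zs) → ∀ {α} → α ∈ as → α ∉ cs
      disjoint sub a with sub a
      ... | here refl = c∉cs
      ... | there q   = disj q ∘ there

    record Link (K : ℕ) (is : List (Fin n)) : Set where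
      field
        linked   : Linked Edge (u ∷ (is ++ v ∷ []))
        length≤  : length is ≤ K
        unique   : Unique is
        fresh    : All (_∉ F) is
        rainbow  : Unique (pathColours c (u ∷ (is ++ v ∷ [])))
        avoids   : All (_∉ Z) (pathColours c (u ∷ (is ++ v ∷ [])))

    link : ∀ {ws} → u ≢ v → RainbowPath Free Z v (u ∷ ws) → ∃ (Link (length ws))
    link {ws} u≢v path = build (strip (RainbowPath.ends path)) path
      where
      strip : ∀ {ws} → EndsAt v (u ∷ ws) → ∃ λ is → ws ≡ is ++ v ∷ []
      strip stop       = contradiction refl u≢v
      strip (_ ∷ ends) = endsAt-∷ʳ ends
      unique-init : ∀ is → Unique (is ++ v ∷ []) → Unique is × All (_≢ v) is
      unique-init []       _        = [] , []
      unique-init (x ∷ is) (d ∷ us) = let us′ , ≢v = unique-init is us in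
        (All.tabulate λ q → All.lookup d (∈-++⁺ˡ q)) ∷ us′ , All.lookup d (∈-++⁺ʳ is (here refl)) ∷ ≢v
      build : ∀ {ws} → ∃ (λ is → ws ≡ is ++ v ∷ []) → RainbowPath Free Z v (u ∷ ws) → ∃ (Link (length ws))
      build (is , refl) path with RainbowPath.unique path
      ... | u∉ ∷ us = is , record
        { linked = linked ; length≤ = ≤-trans (m≤m+n _ _) (≤-reflexive (sym (length-++ is)))
        ; unique = proj₁ (unique-init is us) ; fresh = All.tabulate fresh ; rainbow = rainbow ; avoids = avoids }
        where
        open RainbowPath path
        fresh : ∀ {y} → y ∈ is → y ∉ F
        fresh q with All.lookup within (there (∈-++⁺ˡ q))
        ... | inj₁ y≡u        = contradiction (sym y≡u) (All.lookup u∉ (∈-++⁺ˡ q))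
        ... | inj₂ (inj₁ y≡v) = contradiction y≡v (All.lookup (proj₂ (unique-init is us)) q)
        ... | inj₂ (inj₂ y∉F) = y∉F

hits : List ℕ → List ℕ → ℕ
hits A L = ListAction.sum (map (λ α → ⟦ does (α ∈? L) ⟧) A)

hits≡0⇒∉ : ∀ A {L α} → hits A L ≡ 0 → α ∈ A → α ∉ L
hits≡0⇒∉ (a ∷ A) {L} h (here refl) with a ∈? L
... | no a∉ = a∉
hits≡0⇒∉ (a ∷ A) {L} h (there p) = hits≡0⇒∉ A (m+n≡0⇒n≡0 ⟦ does (a ∈? L) ⟧ h) p

module _ {n : ℕ} (E : Fin n → Fin n → Bool) (Q : Fin n → List ℕ) where

  costs-hits : ∀ A → costs E Q A ≡ ∑ λ w → deg E w * hits A (Q w)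
  costs-hits []      = sym (∑-zero λ w → *-zeroʳ (deg E w))
  costs-hits (α ∷ A) = trans (cong (cost E Q α +_) (costs-hits A))
    (trans (sym (∑-+ _ _)) (∑-cong λ w → sym (*-distribˡ-+ (deg E w) _ _)))

  -- The volumes of `U` and `V` add up to more than 4/3 of the total, which is at least the total
  -- plus the cost. Comparing both sides at each vertex, the strict inequality at some `w` forces
  -- `w` into both sets with no hit.
  disjointMeeting : ∀ A (U V : Fin n → Bool) → 3 * costs E Q A ≤ tot E →
    2 * tot E < 3 * vol E U → 2 * tot E < 3 * vol E V →
    ∃ λ w → U w ≡ true × V w ≡ true × (∀ {α} → α ∈ A → α ∉ Q w)
  disjointMeeting A U V cheap bigU bigV =
    let w , lt = ∑<⇒∃< (subst₂ _<_ lhs rhs total)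
        Uw , Vw , h = both (U w) (V w) (deg E w) (hits A (Q w)) lt
    in w , Uw , Vw , hits≡0⇒∉ A h
    where
    open ≤-Reasoning
    lhs : tot E + costs E Q A ≡ ∑ λ w → deg E w + deg E w * hits A (Q w)
    lhs = trans (cong (tot E +_) (costs-hits A)) (sym (∑-+ _ _))
    rhs : vol E U + vol E V ≡ ∑ λ w → ⟦ U w ⟧ * deg E w + ⟦ V w ⟧ * deg E w
    rhs = sym (∑-+ _ _)
    arith : ∀ t → 3 * t + t ≡ 2 * t + 2 * t
    arith = solve-∀
    total : tot E + costs E Q A < vol E U + vol E V
    total = *-cancelˡ-< 3 _ _ (begin-strict
      3 * (tot E + costs E Q A)        ≡⟨ *-distribˡ-+ 3 (tot E) _ ⟩
      3 * tot E + 3 * costs E Q A      ≤⟨ +-monoʳ-≤ (3 * tot E) cheap ⟩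
      3 * tot E + tot E                ≡⟨ arith (tot E) ⟩
      2 * tot E + 2 * tot E            <⟨ +-mono-< bigU bigV ⟩
      3 * vol E U + 3 * vol E V        ≡⟨ *-distribˡ-+ 3 (vol E U) _ ⟨
      3 * (vol E U + vol E V)          ∎)
    both : ∀ a b d h → d + d * h < ⟦ a ⟧ * d + ⟦ b ⟧ * d → a ≡ true × b ≡ true × h ≡ 0
    both true true d zero lt = refl , refl , refl
    both true true d (suc h) lt = contradiction (≤-trans (≤-reflexive (cong₂ _+_ (*-identityˡ d) (*-identityˡ d)))
      (+-monoʳ-≤ d (m≤m*n d (suc h)))) (<⇒≱ lt)
    both true false d h lt = contradiction (≤-trans (≤-reflexive (trans (+-identityʳ _) (*-identityˡ d))) (m≤m+n d _)) (<⇒≱ lt)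
    both false true d h lt = contradiction (≤-trans (≤-reflexive (*-identityˡ d)) (m≤m+n d _)) (<⇒≱ lt)

module Connection {n : ℕ} (E : Fin n → Fin n → Bool) (c : Fin n → Fin n → ℕ) (pr : ProperOn E c)
  (r δ : ℕ) (ex : Expander E r δ) (C : ℕ) (c<C : ∀ x y → c x y < C)
  (k : ℕ) (k>0 : 0 < k) (eq≤δ : 6 * k * suc k ≤ δ)
  (F : List (Fin n)) (Z : List ℕ)
  (robust : 2 * r * (length F + length Z + k + 6 * k * k) ≤ δ)
  (deep : tot E * (2 * (2 * r)) ^ k < (2 * (2 * r) + 1) ^ k)
  (u v : Fin n) (u≢v : u ≢ v) (u∈F : u ∈ F) (v∈F : v ∈ F) (u>0 : 0 < deg E u) (v>0 : 0 < deg E v)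
  where

  e>0 : 0 < 6 * k
  e>0 = *-mono-≤ {1} {6} (s≤s z≤n) k>0

  -- There are no paths to avoid yet: with empty lists every colour is free, and the same growth
  -- applies.
  module FromV = Growth E c pr r δ ex C c<C (λ _ → []) k (λ _ → z≤n) (6 * k) e>0 eq≤δ F Z robust deep v v>0

  module FromU (iV : ℕ) (iV≤k : iV ≤ k) (V : FromV.Ball iV) (bigV : 2 * tot E < 3 * vol E (FromV.Ball.U V)) where
    module V = FromV.Ball V

    Q : Fin n → List ℕ
    -- Off the ball the empty default adds no cost; the meeting vertex lies in the ball, where `Q w`
    -- is its trail.
    Q w = if V.U w then V.cs w else []

    Q≤k : ∀ w → length (Q w) ≤ k
    Q≤k w with V.U w in eq
    ... | true  = ≤-trans (V.cs≤ w eq) iV≤k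
    ... | false = z≤n

    module GU = Growth E c pr r δ ex C c<C Q k Q≤k (6 * k) e>0 eq≤δ F Z robust deep u u>0

    join : GU.FinalBall → ∃ (Link E c pr F Z u v (k + k))
    join (iU , iU≤k , B , bigU) = meet (disjointMeeting E Q palette U V.U cheap bigU bigV)
      where
      open GU.Ball B
      open ≤-Reasoning
      arith : ∀ k x → 2 * k * (3 * x) ≡ 6 * k * x
      arith = solve-∀
      -- At most `k` rounds at `2 * tot E / (6 * k)` each give a third of the total.
      cheap : 3 * costs E Q palette ≤ tot E
      cheap = *-cancelˡ-≤ (2 * k) {{>-nonZero (*-mono-≤ {1} {2} (s≤s z≤n) k>0)}} (begin
        2 * k * (3 * costs E Q palette)   ≡⟨ arith k (costs E Q palette) ⟩
        6 * k * costs E Q palette         ≤⟨ costs≤ ⟩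
        2 * iU * tot E                    ≤⟨ *-monoˡ-≤ (tot E) (*-monoʳ-≤ 2 iU≤k) ⟩
        2 * k * tot E                     ∎)
      meet : ∃ (λ w → U w ≡ true × V.U w ≡ true × (∀ {α} → α ∈ palette → α ∉ Q w)) → ∃ (Link E c pr F Z u v (k + k))
      meet (w , Uw , Vw , disj) =
        let zs , path , sub , len = fromTrail E c pr F Z u v (V.trail w Vw)
            ws , path′ , len′     = follow E c pr F Z u v (trail w Uw) path
              (λ q q′ → disj (cs⊆ w Uw q′) (subst (_ ∈_) (sym (cong (λ b → if b then V.cs w else []) Vw)) (sub q)))
            is , lk               = link E c pr F Z u v u≢v path′
            bound                 = ≤-trans len′ (+-mono-≤ (≤-trans (cs≤ w Uw) iU≤k) (≤-trans len (≤-trans (V.cs≤ w Vw) iV≤k)))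
        in is , record { Link lk ; length≤ = ≤-trans (Link.length≤ lk) bound }

  opaque
    connection : ∃ (Link E c pr F Z u v (k + k))
    connection = let iV , iV≤k , V , bigV = FromV.finalBall in
      FromU.join iV iV≤k V bigV (FromU.GU.finalBall iV iV≤k V bigV)

-- Extracting an expander

module Extraction {n : ℕ} (adj : Fin n → Fin n → Bool) (adj-sym : ∀ x y → adj x y ≡ adj y x)
  (J′ d δ : ℕ) (2≤d : 2 ≤ d) (4δ≤d : 4 * δ ≤ d) where

  J : ℕ
  J = suc J′

  size : (Fin n → Bool) → ℕ
  size H = ∑ λ x → ⟦ H x ⟧

  induced : (Fin n → Bool) → Fin n → Fin n → Bool
  induced H x y = (H x ∧ H y) ∧ adj x y

  _∩_ : (Fin n → Bool) → (Fin n → Bool) → Fin n → Bool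
  (H ∩ S) x = H x ∧ S x

  D : (Fin n → Bool) → ℕ
  D H = tot (induced H)

  induced-sym : ∀ H x y → induced H x y ≡ induced H y x
  induced-sym H x y = cong₂ _∧_ (∧-comm (H x) (H y)) (adj-sym x y)

  vol-split : ∀ H S → vol (induced H) S ≡ D (H ∩ S) + cut (induced H) S
  vol-split H S = trans (∑-cong pointwise) (∑-+ _ _)
    where
    boolean : ∀ h s h′ s′ a → ⟦ s ⟧ * ⟦ (h ∧ h′) ∧ a ⟧ ≡
      ⟦ ((h ∧ s) ∧ (h′ ∧ s′)) ∧ a ⟧ + ⟦ s ⟧ * (⟦ not s′ ⟧ * ⟦ (h ∧ h′) ∧ a ⟧)
    boolean false false h′    s′    a     = refl
    boolean false true  h′    true  a     = refl
    boolean false true  h′    false a     = refl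
    boolean true  false h′    s′    a     = refl
    boolean true  true  false true  a     = refl
    boolean true  true  false false a     = refl
    boolean true  true  true  true  true  = refl
    boolean true  true  true  true  false = refl
    boolean true  true  true  false true  = refl
    boolean true  true  true  false false = refl
    open ≡-Reasoning
    pointwise : ∀ x → ⟦ S x ⟧ * deg (induced H) x ≡
      deg (induced (H ∩ S)) x + ⟦ S x ⟧ * ∑ (λ y → ⟦ not (S y) ⟧ * ⟦ induced H x y ⟧)
    pointwise x = begin
      ⟦ S x ⟧ * deg (induced H) x
        ≡⟨ *-∑ ⟦ S x ⟧ _ ⟩
      ∑ (λ y → ⟦ S x ⟧ * ⟦ induced H x y ⟧)
        ≡⟨ ∑-cong (λ y → boolean (H x) (S x) (H y) (S y) (adj x y)) ⟩
      ∑ (λ y → ⟦ induced (H ∩ S) x y ⟧ + ⟦ S x ⟧ * (⟦ not (S y) ⟧ * ⟦ induced H x y ⟧))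
        ≡⟨ ∑-+ _ _ ⟩
      deg (induced (H ∩ S)) x + ∑ (λ y → ⟦ S x ⟧ * (⟦ not (S y) ⟧ * ⟦ induced H x y ⟧))
        ≡⟨ cong (deg (induced (H ∩ S)) x +_) (*-∑ ⟦ S x ⟧ _) ⟨
      deg (induced (H ∩ S)) x + ⟦ S x ⟧ * ∑ (λ y → ⟦ not (S y) ⟧ * ⟦ induced H x y ⟧) ∎

  cut-complement : ∀ H S → cut (induced H) (not ∘ S) ≡ cut (induced H) S
  cut-complement H S = begin
    ∑ (λ x → ⟦ not (S x) ⟧ * ∑ λ y → ⟦ not (not (S y)) ⟧ * ⟦ induced H x y ⟧)   ≡⟨ ∑-cong (λ x → *-∑ ⟦ not (S x) ⟧ _) ⟩
    ∑ (λ x → ∑ λ y → ⟦ not (S x) ⟧ * (⟦ not (not (S y)) ⟧ * ⟦ induced H x y ⟧)) ≡⟨ ∑-swap _ ⟩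
    ∑ (λ y → ∑ λ x → ⟦ not (S x) ⟧ * (⟦ not (not (S y)) ⟧ * ⟦ induced H x y ⟧)) ≡⟨ ∑-cong (λ y → ∑-cong (pointwise y)) ⟩
    ∑ (λ y → ∑ λ x → ⟦ S y ⟧ * (⟦ not (S x) ⟧ * ⟦ induced H y x ⟧))             ≡⟨ ∑-cong (λ y → *-∑ ⟦ S y ⟧ _) ⟨
    ∑ (λ y → ⟦ S y ⟧ * ∑ λ x → ⟦ not (S x) ⟧ * ⟦ induced H y x ⟧)               ∎
    where
    open ≡-Reasoning
    arith : ∀ a b e → a * (b * e) ≡ b * (a * e)
    arith = solve-∀
    not-not : ∀ b → not (not b) ≡ b
    not-not true  = refl
    not-not false = refl
    pointwise : ∀ y x → ⟦ not (S x) ⟧ * (⟦ not (not (S y)) ⟧ * ⟦ induced H x y ⟧) ≡ ⟦ S y ⟧ * (⟦ not (S x) ⟧ * ⟦ induced H y x ⟧)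
    pointwise y x rewrite not-not (S y) | induced-sym H x y = arith ⟦ not (S x) ⟧ ⟦ S y ⟧ ⟦ induced H y x ⟧

  D-split : ∀ H S → D H ≡ vol (induced H) S + (D (H ∩ (not ∘ S)) + cut (induced H) S)
  D-split H S = begin
    D H                                                      ≡⟨ ∑-cong pointwise ⟩
    ∑ (λ x → ⟦ S x ⟧ * deg (induced H) x + ⟦ not (S x) ⟧ * deg (induced H) x) ≡⟨ ∑-+ _ _ ⟩
    vol (induced H) S + vol (induced H) (not ∘ S)            ≡⟨ cong (vol (induced H) S +_) (vol-split H (not ∘ S)) ⟩
    vol (induced H) S + (D (H ∩ (not ∘ S)) + cut (induced H) (not ∘ S)) ≡⟨ cong (λ t → vol (induced H) S + (D (H ∩ (not ∘ S)) + t)) (cut-complement H S) ⟩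
    vol (induced H) S + (D (H ∩ (not ∘ S)) + cut (induced H) S) ∎
    where
    open ≡-Reasoning
    pointwise : ∀ x → deg (induced H) x ≡ ⟦ S x ⟧ * deg (induced H) x + ⟦ not (S x) ⟧ * deg (induced H) x
    pointwise x with S x
    ... | true  = sym (trans (+-identityʳ _) (*-identityˡ _))
    ... | false = sym (*-identityˡ _)

  size-split : ∀ H S → size H ≡ size (H ∩ S) + size (H ∩ (not ∘ S))
  size-split H S = trans (∑-cong λ x → boolean (H x) (S x)) (∑-+ _ _)
    where
    boolean : ∀ h s → ⟦ h ⟧ ≡ ⟦ h ∧ s ⟧ + ⟦ h ∧ not s ⟧
    boolean false _     = refl
    boolean true  true  = refl
    boolean true  false = refl

  deg⇒member : ∀ H x → 0 < deg (induced H) x → H x ≡ true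
  deg⇒member H x p with ∑-pos p
  ... | y , q = proj₁ (∧-true {H x} {H y} (proj₁ (∧-true {H x ∧ H y} (⟦⟧-pos q))))

  0<size : ∀ H x → H x ≡ true → 0 < size H
  0<size H x p = <-≤-trans (subst (λ b → 0 < ⟦ b ⟧) (sym p) z<s) (term≤∑ (λ x → ⟦ H x ⟧) x)

  -- The level j bounds log D to base 3/2.  The required density falls only from
  -- d to d / 2 as the level drops from J to 0, where nothing is dense.
  record Dense (j : ℕ) (H : Fin n → Bool) : Set where
    field
      level : j ≤ J
      dense : d * (J + j) * size H < 2 * J * D H
      small : 2 ^ j * D H ≤ 3 ^ j

  0<D : ∀ {j H} → Dense j H → 0 < D H
  0<D dn = <*⇒0<ʳ (2 * J) (Dense.dense dn)

  -- `small` leaves `D H ≤ 1`, too little for even one vertex at density `d / 2 ≥ 1`.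
  ¬dense₀ : ∀ {H} → ¬ Dense 0 H
  ¬dense₀ {H} dn = <-irrefl refl (begin-strict
    2 * J                     ≤⟨ *-monoˡ-≤ J 2≤d ⟩
    d * J                     ≡⟨ cong (d *_) (+-identityʳ J) ⟨
    d * (J + 0)               ≡⟨ *-identityʳ _ ⟨
    d * (J + 0) * 1           ≤⟨ *-monoʳ-≤ (d * (J + 0)) nonempty ⟩
    d * (J + 0) * size H      <⟨ dense ⟩
    2 * J * D H               ≤⟨ *-monoʳ-≤ (2 * J) (≤-trans (≤-reflexive (sym (*-identityˡ _))) small) ⟩
    2 * J * 1                 ≡⟨ *-identityʳ _ ⟩
    2 * J                     ∎)
    where
    open Dense dn
    open ≤-Reasoning
    nonempty : 1 ≤ size H
    nonempty = let x , p = ∑-pos (0<D dn) in 0<size H x (deg⇒member H x p)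

  Result : Set
  Result = ∃ λ H → Expander (induced H) (4 * J) δ

  SparseCut : (Fin n → Bool) → (Fin n → Bool) → Set
  SparseCut H S = 3 * vol (induced H) S ≤ 2 * D H × 4 * J * cut (induced H) S < vol (induced H) S

  -- If the part outside S is sparser than H, the excess edges belong to S; of these
  -- S loses only a 1 / (4 J) fraction, which is what one level is worth.
  splitSparse : ∀ j H S → Dense (suc j) H → SparseCut H S →
    (Dense (suc j) (H ∩ (not ∘ S)) × size (H ∩ (not ∘ S)) < size H) ⊎ Dense j (H ∩ S)
  splitSparse j H S dn (balanced , sparse) = choose (<-≤-connex (d * (J + suc j) * size B) (2 * J * D B))
    where
    open Dense dn
    open ≤-Reasoning
    A = H ∩ S
    B = H ∩ (not ∘ S)
    a = size A
    b = size B
    κ = cut (induced H) S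
    -- This is `4 * J - 1`: since the volume of `S` is `D A + κ`, sparseness of the cut becomes
    -- `P * κ ≤ D A`.
    P = 3 + 4 * J′
    M = J + j
    DH : D H ≡ D A + κ + (D B + κ)
    DH = trans (D-split H S) (cong (_+ (D B + κ)) (vol-split H S))
    0<vol : 0 < vol (induced H) S
    0<vol = ≤-<-trans z≤n sparse
    B<H : size B < size H
    B<H = ≤-trans (+-monoˡ-≤ b nonempty) (≤-reflexive (sym (size-split H S)))
      where
      nonempty : 1 ≤ size A
      nonempty with ∑-pos 0<vol
      ... | x , q with 0<⟦⟧* (S x) q
      ... | Sx , dx = 0<size A x (cong₂ _∧_ (deg⇒member H x dx) Sx)
    DB≤DH : D B ≤ D H
    DB≤DH = ≤-trans (m≤m+n (D B) κ) (≤-trans (m≤n+m _ (D A + κ)) (≤-reflexive (sym DH)))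
    arith₁ : ∀ J′ → 4 * suc J′ ≡ 3 + 4 * J′ + 1
    arith₁ = solve-∀
    Pκ≤DA : P * κ ≤ D A
    Pκ≤DA = +-cancelʳ-≤ κ _ _ (begin
      P * κ + κ              ≡⟨ cong (P * κ +_) (*-identityˡ κ) ⟨
      P * κ + 1 * κ          ≡⟨ *-distribʳ-+ κ P 1 ⟨
      (P + 1) * κ            ≡⟨ cong (_* κ) (arith₁ J′) ⟨
      4 * J * κ              ≤⟨ <⇒≤ sparse ⟩
      vol (induced H) S      ≡⟨ vol-split H S ⟩
      D A + κ                ∎)
    2M≤P : 2 * M ≤ P
    2M≤P = begin
      2 * (J + j)             ≤⟨ *-monoʳ-≤ 2 (+-monoʳ-≤ J (s≤s⁻¹ level)) ⟩
      2 * (suc J′ + J′)       ≡⟨ arith J′ ⟩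
      2 + 4 * J′              ≤⟨ n≤1+n _ ⟩
      P                       ∎
      where
      arith : ∀ J′ → 2 * (suc J′ + J′) ≡ 2 + 4 * J′
      arith = solve-∀
    choose : d * (J + suc j) * size B < 2 * J * D B ⊎ 2 * J * D B ≤ d * (J + suc j) * size B →
      (Dense (suc j) B × size B < size H) ⊎ Dense j A
    choose (inj₁ denseB) = inj₁ (record
      { level = level ; dense = denseB ; small = ≤-trans (*-monoʳ-≤ (2 ^ suc j) DB≤DH) small } , B<H)
    choose (inj₂ sparseB) = inj₂ (record
      { level = ≤-trans (n≤1+n j) level ; dense = denseA ; small = smallA })
      where
      arith₂ : ∀ K x k b → K * (x + k + (b + k)) ≡ K * (x + 2 * k) + K * b
      arith₂ = solve-∀
      h₁ : d * (J + suc j) * a < 2 * J * (D A + 2 * κ)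
      h₁ = +-cancelʳ-< (d * (J + suc j) * b) _ _ (begin-strict
        d * (J + suc j) * a + d * (J + suc j) * b   ≡⟨ *-distribˡ-+ (d * (J + suc j)) a b ⟨
        d * (J + suc j) * (a + b)                   ≡⟨ cong (d * (J + suc j) *_) (size-split H S) ⟨
        d * (J + suc j) * size H                    <⟨ dense ⟩
        2 * J * D H                                 ≡⟨ cong (2 * J *_) DH ⟩
        2 * J * (D A + κ + (D B + κ))               ≡⟨ arith₂ (2 * J) (D A) κ (D B) ⟩
        2 * J * (D A + 2 * κ) + 2 * J * D B         ≤⟨ +-monoʳ-≤ _ sparseB ⟩
        2 * J * (D A + 2 * κ) + d * (J + suc j) * b ∎)
      arith₃ : ∀ P d m a → (P + 2) * (d * m * a) ≡ d * a * (P * m + 2 * m)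
      arith₃ = solve-∀
      arith₄ : ∀ P d J j a → d * a * (P * (J + j) + P) ≡ P * (d * (J + suc j) * a)
      arith₄ = solve-∀
      arith₅ : ∀ P K x k → P * (K * (x + 2 * k)) ≡ K * (P * x + 2 * (P * k))
      arith₅ = solve-∀
      arith₆ : ∀ P K x → K * (P * x + 2 * x) ≡ (P + 2) * (K * x)
      arith₆ = solve-∀
      -- Multiplying `h₁` by `P` and using `P * κ ≤ D A` compares `P * (M + 1) * d * a` with
      -- `(P + 2) * 2 * J * D A`. The lower level needs only `(P + 2) * M ≤ P * (M + 1)`, which is
      -- `2 * M ≤ P`.
      denseA : d * M * a < 2 * J * D A
      denseA = *-cancelˡ-< (P + 2) _ _ (begin-strict
        (P + 2) * (d * M * a)                      ≡⟨ arith₃ P d M a ⟩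
        d * a * (P * M + 2 * M)                    ≤⟨ *-monoʳ-≤ (d * a) (+-monoʳ-≤ (P * M) 2M≤P) ⟩
        d * a * (P * M + P)                        ≡⟨ arith₄ P d J j a ⟩
        P * (d * (J + suc j) * a)                  <⟨ *-monoʳ-< P h₁ ⟩
        P * (2 * J * (D A + 2 * κ))                ≡⟨ arith₅ P (2 * J) (D A) κ ⟩
        2 * J * (P * D A + 2 * (P * κ))            ≤⟨ *-monoʳ-≤ (2 * J) (+-monoʳ-≤ (P * D A) (*-monoʳ-≤ 2 Pκ≤DA)) ⟩
        2 * J * (P * D A + 2 * D A)                ≡⟨ arith₆ P (2 * J) (D A) ⟩
        (P + 2) * (2 * J * D A)                    ∎)
      DA≤vol : D A ≤ vol (induced H) S
      DA≤vol = ≤-trans (m≤m+n (D A) κ) (≤-reflexive (sym (vol-split H S)))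
      arith₇ : ∀ p x → 3 * (p * x) ≡ p * (3 * x)
      arith₇ = solve-∀
      arith₈ : ∀ p x → p * (2 * x) ≡ 2 * p * x
      arith₈ = solve-∀
      smallA : 2 ^ j * D A ≤ 3 ^ j
      smallA = *-cancelˡ-≤ 3 (begin
        3 * (2 ^ j * D A)                    ≡⟨ arith₇ (2 ^ j) (D A) ⟩
        2 ^ j * (3 * D A)                    ≤⟨ *-monoʳ-≤ (2 ^ j) (≤-trans (*-monoʳ-≤ 3 DA≤vol) balanced) ⟩
        2 ^ j * (2 * D H)                    ≡⟨ arith₈ (2 ^ j) (D H) ⟩
        2 ^ suc j * D H                      ≤⟨ small ⟩
        3 ^ suc j                            ∎)

  -- `D` loses at most twice the degree of `x`, and `4 * δ ≤ d` makes this no more than the share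
  -- that the density condition assigns to one vertex.
  removeVertex : ∀ j H x → Dense j H → H x ≡ true → deg (induced H) x < δ →
    let B = H ∩ (not ∘ λ y → does (y Fin.≟ x)) in Dense j B × size B < size H
  removeVertex j H x dn Hx low = record { level = level ; dense = denseB ; small = ≤-trans (*-monoʳ-≤ (2 ^ j) DB≤DH) small }
    , ≤-reflexive (sym size≡)
    where
    open Dense dn
    open ≤-Reasoning
    S : Fin n → Bool
    S y = does (y Fin.≟ x)
    B = H ∩ (not ∘ S)
    κ = cut (induced H) S
    singleton : ∀ (f : Fin n → ℕ) → ∑ (λ y → ⟦ S y ⟧ * f y) ≡ f x
    singleton f = trans (∑-cong same) (trans (sym (∑-* (f x) _)) (trans (cong (_* f x) (∑-indicator x)) (*-identityˡ (f x))))
      where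
      same : ∀ y → ⟦ S y ⟧ * f y ≡ ⟦ S y ⟧ * f x
      same y with y Fin.≟ x
      ... | yes refl = refl
      ... | no _     = refl
    size≡ : size H ≡ suc (size B)
    size≡ = trans (size-split H S) (cong (_+ size B) (trans (∑-cong λ y → trans (⟦⟧-∧ (H y) (S y)) (*-comm ⟦ H y ⟧ ⟦ S y ⟧))
      (trans (singleton (λ y → ⟦ H y ⟧)) (cong ⟦_⟧ Hx))))
    δx = deg (induced H) x
    κ≤ : κ ≤ δx
    κ≤ = ≤-trans (m≤n+m κ (D (H ∩ S))) (≤-trans (≤-reflexive (sym (vol-split H S))) (≤-reflexive (singleton (deg (induced H)))))
    DH≤ : D H ≤ D B + 2 * δx
    DH≤ = begin
      D H                                     ≡⟨ D-split H S ⟩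
      vol (induced H) S + (D B + κ)           ≤⟨ +-mono-≤ (≤-reflexive (singleton (deg (induced H)))) (+-monoʳ-≤ (D B) κ≤) ⟩
      δx + (D B + δx)                         ≡⟨ arith δx (D B) ⟩
      D B + 2 * δx                            ∎
      where
      arith : ∀ x b → x + (b + x) ≡ b + 2 * x
      arith = solve-∀
    DB≤DH : D B ≤ D H
    DB≤DH = ≤-trans (m≤m+n (D B) κ) (≤-trans (m≤n+m _ (vol (induced H) S)) (≤-reflexive (sym (D-split H S))))
    arith₁ : ∀ t s → t * suc s ≡ t * s + t
    arith₁ = solve-∀
    arith₂ : ∀ J b x → 2 * J * (b + 2 * x) ≡ 2 * J * b + 4 * x * J
    arith₂ = solve-∀
    denseB : d * (J + j) * size B < 2 * J * D B
    denseB = +-cancelʳ-< (d * (J + j)) _ _ (begin-strict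
      d * (J + j) * size B + d * (J + j)     ≡⟨ arith₁ (d * (J + j)) (size B) ⟨
      d * (J + j) * suc (size B)             ≡⟨ cong (d * (J + j) *_) size≡ ⟨
      d * (J + j) * size H                   <⟨ dense ⟩
      2 * J * D H                            ≤⟨ *-monoʳ-≤ (2 * J) DH≤ ⟩
      2 * J * (D B + 2 * δx)                 ≡⟨ arith₂ J (D B) δx ⟩
      2 * J * D B + 4 * δx * J               ≤⟨ +-monoʳ-≤ (2 * J * D B) (*-mono-≤ (≤-trans (*-monoʳ-≤ 4 (<⇒≤ low)) 4δ≤d) (m≤m+n J j)) ⟩
      2 * J * D B + d * (J + j)              ∎)

  -- The search runs over subsets as bit vectors; a Boolean function agrees with its table
  -- pointwise, which suffices for `vol` and `cut`.
  sparseCut? : ∀ H → (∃ (SparseCut H)) ⊎ (∀ S → ¬ SparseCut H S)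
  sparseCut? H with anySubset? {n = n} {P = SparseCut H ∘ Vec.lookup}
    (λ p → (3 * vol (induced H) (Vec.lookup p) ≤? 2 * D H) ×-dec (4 * J * cut (induced H) (Vec.lookup p) <? vol (induced H) (Vec.lookup p)))
  ... | yes (p , q) = inj₁ (Vec.lookup p , q)
  ... | no none     = inj₂ λ S (b , sp) → none (Vec.tabulate S ,
    subst (λ v → 3 * v ≤ 2 * D H) (vol≡ S) b , subst₂ (λ κ v → 4 * J * κ < v) (cut≡ S) (vol≡ S) sp)
    where
    S≡ : ∀ S x → S x ≡ Vec.lookup (Vec.tabulate S) x
    S≡ S x = sym (lookup∘tabulate S x)
    vol≡ : ∀ S → vol (induced H) S ≡ vol (induced H) (Vec.lookup (Vec.tabulate S))
    vol≡ S = ∑-cong λ x → cong (λ b → ⟦ b ⟧ * deg (induced H) x) (S≡ S x)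
    cut≡ : ∀ S → cut (induced H) S ≡ cut (induced H) (Vec.lookup (Vec.tabulate S))
    cut≡ S = ∑-cong λ x → cong₂ (λ b m → ⟦ b ⟧ * m) (S≡ S x)
      (∑-cong λ y → cong (λ b → ⟦ not b ⟧ * ⟦ induced H x y ⟧) (S≡ S y))

  lowDegree? : ∀ H → (∃ λ x → H x ≡ true × deg (induced H) x < δ) ⊎ (∀ x → H x ≡ true → δ ≤ deg (induced H) x)
  lowDegree? H with Fin.any? (λ x → (H x Bool.≟ true) ×-dec (deg (induced H) x <? δ))
  ... | yes p   = inj₁ p
  ... | no none = inj₂ λ x Hx → ≮⇒≥ λ lt → none (x , Hx , lt)

  -- The two continuations are the two ways to descend: fewer vertices at the same level, or a lower
  -- level.
  splitOrStop : ∀ j H → Dense (suc j) H →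
    (∀ B → size B < size H → Dense (suc j) B → Result) → (∀ A → Dense j A → Result) → Result
  splitOrStop j H dn sameLevel lower = lowDegree (lowDegree? H)
    where
    split : ∀ S → (Dense (suc j) (H ∩ (not ∘ S)) × size (H ∩ (not ∘ S)) < size H) ⊎ Dense j (H ∩ S) → Result
    split S (inj₁ (dn′ , lt)) = sameLevel _ lt dn′
    split S (inj₂ dn′)        = lower _ dn′
    sparseCut : (∀ x → H x ≡ true → δ ≤ deg (induced H) x) → (∃ (SparseCut H)) ⊎ (∀ S → ¬ SparseCut H S) → Result
    sparseCut high (inj₁ (S , sparse)) = split S (splitSparse j H S dn sparse)
    sparseCut high (inj₂ none) = H , record
      { nonempty = 0<D dn
      ; minDeg   = λ x p → high x (deg⇒member H x p)
      ; expands  = λ S b → ≮⇒≥ λ lt → none S (b , lt) }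
    lowDegree : (∃ λ x → H x ≡ true × deg (induced H) x < δ) ⊎ (∀ x → H x ≡ true → δ ≤ deg (induced H) x) → Result
    lowDegree (inj₁ (x , Hx , low)) = let dn′ , lt = removeVertex (suc j) H x dn Hx low in sameLevel _ lt dn′
    lowDegree (inj₂ high) = sparseCut high (sparseCut? H)

  -- Lexicographic recursion on level and size; when the level drops, the fuel is set afresh.
  extract : ∀ j fuel H → size H ≤ fuel → Dense j H → Result
  extract zero    fuel       H s≤ dn = contradiction dn ¬dense₀
  extract (suc j) zero       H s≤ dn = contradiction
    (let x , p = ∑-pos (0<D dn) in <-≤-trans (0<size H x (deg⇒member H x p)) s≤) λ ()
  extract (suc j) (suc fuel) H s≤ dn = splitOrStop j H dn
    (λ B lt → extract (suc j) fuel B (s≤s⁻¹ (≤-trans lt s≤)))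
    (λ A → extract j (size A) A ≤-refl)

-- Routing all pairs

module _ {A : Set} {P : A → Set} (P? : Decidable P) where

  length-filter-tabulate : ∀ {n} (f : Fin n → A) → length (filter P? (tabulate f)) ≡ ∑ λ i → ⟦ does (P? (f i)) ⟧
  length-filter-tabulate {zero}  f = sym (∑-zero {0} λ ())
  length-filter-tabulate {suc n} f with does (P? (f zero)) in eq
  ... | true  = trans (cong suc (length-filter-tabulate (f ∘ suc))) (sym (trans (∑-suc _) (cong (λ b → ⟦ b ⟧ + ∑ (λ i → ⟦ does (P? (f (suc i))) ⟧)) eq)))
  ... | false = trans (length-filter-tabulate (f ∘ suc)) (sym (trans (∑-suc _) (cong (λ b → ⟦ b ⟧ + ∑ (λ i → ⟦ does (P? (f (suc i))) ⟧)) eq)))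

module _ {A B : Set} {P : A × B → Set} (P? : Decidable P) where

  length-filter-cartesianProduct : ∀ {m n} (f : Fin m → A) (g : Fin n → B) →
    length (filter P? (cartesianProduct (tabulate f) (tabulate g))) ≡ ∑ λ i → ∑ λ j → ⟦ does (P? (f i , g j)) ⟧
  length-filter-cartesianProduct {zero}  f g = sym (∑-zero {0} λ ())
  length-filter-cartesianProduct {suc m} f g = begin
    length (filter P? (map (f zero ,_) (tabulate g) ++ rest))
      ≡⟨ cong length (filter-++ P? (map (f zero ,_) (tabulate g)) rest) ⟩
    length (filter P? (map (f zero ,_) (tabulate g)) ++ filter P? rest)
      ≡⟨ length-++ (filter P? (map (f zero ,_) (tabulate g))) ⟩
    length (filter P? (map (f zero ,_) (tabulate g))) + length (filter P? rest)
      ≡⟨ cong₂ _+_ (trans (cong (length ∘ filter P?) (map-tabulate g (f zero ,_))) (length-filter-tabulate P? ((f zero ,_) ∘ g)))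
           (length-filter-cartesianProduct (f ∘ suc) g) ⟩
    ∑ (λ j → ⟦ does (P? (f zero , g j)) ⟧) + ∑ (λ i → ∑ λ j → ⟦ does (P? (f (suc i) , g j)) ⟧)
      ≡⟨ ∑-suc _ ⟨
    ∑ (λ i → ∑ λ j → ⟦ does (P? (f i , g j)) ⟧) ∎
    where
    open ≡-Reasoning
    rest = cartesianProduct (tabulate (f ∘ suc)) (tabulate g)

lookup-injective : ∀ {A : Set} {xs : List A} → Unique xs → ∀ i j → lookup xs i ≡ lookup xs j → i ≡ j
lookup-injective (d ∷ us) zero    zero    eq = refl
lookup-injective (d ∷ us) zero    (suc j) eq = contradiction eq (All.lookup d (∈-lookup j))
lookup-injective (d ∷ us) (suc i) zero    eq = contradiction (sym eq) (All.lookup d (∈-lookup i))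
lookup-injective (d ∷ us) (suc i) (suc j) eq = cong suc (lookup-injective us i j eq)

choose : ∀ {n} (b : Fin n → Bool) m → m ≤ ∑ (λ x → ⟦ b x ⟧) →
  ∃ λ (f : Fin m → Fin n) → (∀ i j → f i ≡ f j → i ≡ j) × (∀ i → b (f i) ≡ true)
choose {n} b m m≤ = f , injective , λ i → proj₂ (∈-filter⁻ P? {xs = allFin n} (∈-lookup {xs = xs} (inject≤ i m≤length)))
  where
  P? : Decidable (λ x → b x ≡ true)
  P? x = b x Bool.≟ true
  xs : List (Fin n)
  xs = filter P? (allFin n)
  does-≟ : ∀ b → does (b Bool.≟ true) ≡ b
  does-≟ true  = refl
  does-≟ false = refl
  m≤length : m ≤ length xs
  m≤length = ≤-trans m≤ (≤-reflexive (sym (trans (length-filter-tabulate P? id) (∑-cong λ x → cong ⟦_⟧ (does-≟ (b x))))))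
  f : Fin m → Fin n
  f i = lookup xs (inject≤ i m≤length)
  injective : ∀ i j → f i ≡ f j → i ≡ j
  injective i j eq = Fin.inject≤-injective m≤length m≤length i j
    (lookup-injective (Unique.filter⁺ P? (Unique.allFin⁺ n)) _ _ eq)

length-concatMap≤ : ∀ {A B : Set} {f : A → List B} {K} {xs : List A} →
  All (λ x → length (f x) ≤ K) xs → length (concatMap f xs) ≤ length xs * K
length-concatMap≤ []                 = z≤n
length-concatMap≤ {f = f} (_∷_ {x} p ps) = ≤-trans (≤-reflexive (length-++ (f x))) (+-mono-≤ p (length-concatMap≤ ps))

Unique-insert : ∀ {A : Set} (xs : List A) {ys zs} → Unique (xs ++ zs) → Unique ys → All (_∉ xs ++ zs) ys →
  Unique (xs ++ (ys ++ zs))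
Unique-insert []       us  vs new = Unique.++⁺ vs us λ (p , q) → All.lookup new p q
Unique-insert (x ∷ xs) {ys} {zs} (d ∷ us) vs new =
  All.tabulate fresh ∷ Unique-insert xs us vs (All.map (_∘ there) new)
  where
  fresh : ∀ {y} → y ∈ xs ++ (ys ++ zs) → x ≢ y
  fresh p with ∈-++⁻ xs p
  ... | inj₁ q = All.lookup d (∈-++⁺ˡ q)
  ... | inj₂ q with ∈-++⁻ ys q
  ... | inj₁ r = λ { refl → All.lookup new r (here refl) }
  ... | inj₂ r = All.lookup d (∈-++⁺ʳ xs r)

length-pathColours : ∀ {n} (c : Colouring n) x xs → length (pathColours c (x ∷ xs)) ≡ length xs
length-pathColours c x []       = refl
length-pathColours c x (y ∷ xs) = cong suc (length-pathColours c y xs)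

module Routing {n : ℕ} (E : Fin n → Fin n → Bool) (c : Fin n → Fin n → ℕ) (pr : ProperOn E c)
  {m : ℕ} (branch : Fin m → Fin n) (branch-inj : ∀ i j → branch i ≡ branch j → i ≡ j) (K B : ℕ)
  (connect : ∀ F Z u v → length F ≤ m + B * K → length Z ≤ B * suc K →
    u ≢ v → u ∈ F → v ∈ F → (∃ λ i → u ≡ branch i) → (∃ λ i → v ≡ branch i) → ∃ (Link E c pr F Z u v K))
  where

  Pair : Set
  Pair = Fin m × Fin m

  _≟ₚ_ : (p q : Pair) → Dec (p ≡ q)
  _≟ₚ_ = ≡-dec Fin._≟_ Fin._≟_

  full : (Pair → List (Fin n)) → Pair → List (Fin n)
  full path p = branch (proj₁ p) ∷ (path p ++ branch (proj₂ p) ∷ [])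

  branches : List (Fin n)
  branches = map branch (allFin m)

  record Routes (ps : List Pair) : Set where
    field
      path     : Pair → List (Fin n)
      linked   : All (λ p → Linked (Edge E c pr) (full path p)) ps
      short    : All (λ p → length (path p) ≤ K) ps
      disjoint : Unique (branches ++ concatMap path ps)
      rainbow  : Unique (concatMap (pathColours c ∘ full path) ps)

  branch∈ : ∀ i xs → branch i ∈ branches ++ xs
  branch∈ i xs = ∈-++⁺ˡ (∈-map⁺ branch (∈-allFin i))

  module Extend (p : Pair) (ps : List Pair) (p∉ps : All (p ≢_) ps) (R : Routes ps) (is : List (Fin n))
    (lk : Link E c pr (branches ++ concatMap (Routes.path R) ps) (concatMap (pathColours c ∘ full (Routes.path R)) ps)
      (branch (proj₁ p)) (branch (proj₂ p)) K is)
    where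
    open Routes R
    module L = Link lk

    path′ : Pair → List (Fin n)
    path′ q with p ≟ₚ q
    ... | yes _ = is
    ... | no _  = path q

    path′-p : path′ p ≡ is
    path′-p with p ≟ₚ p
    ... | yes _ = refl
    ... | no ¬r = contradiction refl ¬r

    path′-q : ∀ {q} → p ≢ q → path′ q ≡ path q
    path′-q {q} p≢q with p ≟ₚ q
    ... | yes r = contradiction r p≢q
    ... | no _  = refl

    old : ∀ {R : Pair → List (Fin n) → Set} → All (λ q → R q (path q)) ps → All (λ q → R q (path′ q)) ps
    old {R} all = All.map (λ {q} (p≢q , r) → subst (R q) (sym (path′-q p≢q)) r) (All.zip (p∉ps , all))

    concat-old : ∀ {A : Set} (f : Pair → List (Fin n) → List A) →
      concatMap (λ q → f q (path′ q)) (p ∷ ps) ≡ f p is ++ concatMap (λ q → f q (path q)) ps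
    concat-old f = cong₂ _++_ (cong (f p) path′-p)
      (cong concat (map-cong-local (All.map (λ {q} p≢q → cong (f q) (path′-q p≢q)) p∉ps)))

    routes : Routes (p ∷ ps)
    routes = record
      { path     = path′
      ; linked   = subst (λ is → Linked (Edge E c pr) (branch (proj₁ p) ∷ (is ++ branch (proj₂ p) ∷ []))) (sym path′-p) L.linked ∷
                   old {λ q is → Linked (Edge E c pr) (branch (proj₁ q) ∷ (is ++ branch (proj₂ q) ∷ []))} linked
      ; short    = subst (λ is → length is ≤ K) (sym path′-p) L.length≤ ∷ old {λ _ is → length is ≤ K} short
      ; disjoint = subst (λ xs → Unique (branches ++ xs)) (sym (concat-old λ _ is → is)) (Unique-insert branches disjoint L.unique L.fresh)
      ; rainbow  = subst Unique (sym (concat-old λ q is → pathColours c (branch (proj₁ q) ∷ (is ++ branch (proj₂ q) ∷ []))))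
                   (Unique-insert [] rainbow L.rainbow L.avoids) }

  length-full : ∀ {path p} → length (path p) ≤ K → length (pathColours c (full path p)) ≤ suc K
  length-full {path} {p} short = ≤-trans (≤-reflexive (trans (length-pathColours c _ (path p ++ _))
    (trans (length-++ (path p)) (+-comm (length (path p)) 1)))) (s≤s short)

  -- All branch vertices and earlier interiors are forbidden to the next path, and so are all
  -- earlier colours. A path with at most `K` interior vertices uses at most `suc K` colours.
  route : ∀ ps → length ps ≤ B → Unique ps → All (λ p → proj₁ p ≢ proj₂ p) ps → Routes ps
  route []       ps≤ us ne = record
    { path = λ _ → [] ; linked = [] ; short = []
    ; disjoint = Unique-insert [] [] branches-unique (All.tabulate λ _ ())
    ; rainbow = [] }
    where
    branches-unique : Unique branches
    branches-unique = Unique.map⁺ (λ {i} {j} → branch-inj i j) (Unique.allFin⁺ m)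
  route (p ∷ ps) ps≤ (p∉ps ∷ us) (p₁≢p₂ ∷ ne) = Extend.routes p ps p∉ps R (proj₁ lk) (proj₂ lk)
    where
    R : Routes ps
    R = route ps (≤-trans (n≤1+n _) ps≤) us ne
    open Routes R
    F≤ : length (branches ++ concatMap path ps) ≤ m + B * K
    F≤ = ≤-trans (≤-reflexive (length-++ branches)) (+-mono-≤
      (≤-reflexive (trans (length-map branch (allFin m)) (length-tabulate {n = m} id)))
      (≤-trans (length-concatMap≤ short) (*-monoˡ-≤ K (≤-trans (n≤1+n _) ps≤))))
    Z≤ : length (concatMap (pathColours c ∘ full path) ps) ≤ B * suc K
    Z≤ = ≤-trans (length-concatMap≤ (All.map (λ {q} → length-full {path} {q}) short)) (*-monoˡ-≤ (suc K) (≤-trans (n≤1+n _) ps≤))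
    lk : ∃ (Link E c pr (branches ++ concatMap path ps) (concatMap (pathColours c ∘ full path) ps) (branch (proj₁ p)) (branch (proj₂ p)) K)
    lk = connect _ _ (branch (proj₁ p)) (branch (proj₂ p)) F≤ Z≤ (p₁≢p₂ ∘ branch-inj _ _)
      (branch∈ (proj₁ p) _) (branch∈ (proj₂ p) _) (proj₁ p , refl) (proj₂ p , refl)

-- The choice of parameters

-- Bernoulli's inequality for `(1 + 1 / X) ^ i`, cleared of fractions.
bernoulli : ∀ X i → (X + i) * X ^ i ≤ X * (X + 1) ^ i
bernoulli X zero    = ≤-reflexive (cong (_* 1) (+-identityʳ X))
bernoulli X (suc i) = begin
  (X + suc i) * (X * X ^ i)              ≤⟨ m≤m+n _ (i * X ^ i) ⟩
  (X + suc i) * (X * X ^ i) + i * X ^ i  ≡⟨ arith X i (X ^ i) ⟩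
  (X + 1) * ((X + i) * X ^ i)            ≤⟨ *-monoʳ-≤ (X + 1) (bernoulli X i) ⟩
  (X + 1) * (X * (X + 1) ^ i)            ≡⟨ arith′ X ((X + 1) ^ i) ⟩
  X * ((X + 1) * (X + 1) ^ i)            ∎
  where
  open ≤-Reasoning
  arith : ∀ X i p → (X + suc i) * (X * p) + i * p ≡ (X + 1) * ((X + i) * p)
  arith = solve-∀
  arith′ : ∀ X p → (X + 1) * (X * p) ≡ X * ((X + 1) * p)
  arith′ = solve-∀

doubling : ∀ X .{{_ : NonZero X}} → 2 * X ^ X ≤ (X + 1) ^ X
doubling X = *-cancelˡ-≤ X (begin
  X * (2 * X ^ X)       ≡⟨ arith X (X ^ X) ⟩
  (X + X) * X ^ X       ≤⟨ bernoulli X X ⟩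
  X * (X + 1) ^ X       ∎)
  where
  open ≤-Reasoning
  arith : ∀ X p → X * (2 * p) ≡ (X + X) * p
  arith = solve-∀

^-distribʳ-* : ∀ a b e → (a * b) ^ e ≡ a ^ e * b ^ e
^-distribʳ-* a b zero    = refl
^-distribʳ-* a b (suc e) = trans (cong (a * b *_) (^-distribʳ-* a b e)) (arith a b (a ^ e) (b ^ e))
  where
  arith : ∀ a b p q → a * b * (p * q) ≡ a * p * (b * q)
  arith = solve-∀

-- By `doubling`, every block of `X` rounds at least doubles the volume.
deepEnough : ∀ X .{{_ : NonZero X}} b {t} → t < 2 ^ b → t * X ^ (X * b) < (X + 1) ^ (X * b)
deepEnough X b {t} t< = begin-strict
  t * X ^ (X * b)          <⟨ *-monoˡ-< (X ^ (X * b)) {{m^n≢0 X (X * b)}} t< ⟩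
  2 ^ b * X ^ (X * b)      ≡⟨ cong (2 ^ b *_) (^-*-assoc X X b) ⟨
  2 ^ b * (X ^ X) ^ b      ≡⟨ ^-distribʳ-* 2 (X ^ X) b ⟨
  (2 * X ^ X) ^ b          ≤⟨ ^-monoˡ-≤ b (doubling X) ⟩
  ((X + 1) ^ X) ^ b        ≡⟨ ^-*-assoc (X + 1) X b ⟩
  (X + 1) ^ (X * b)        ∎
  where open ≤-Reasoning

n<2^n : ∀ n → n < 2 ^ n
n<2^n zero    = z<s
n<2^n (suc n) = +-mono-≤ {1} (m^n>0 2 n) (≤-trans (n<2^n n) (≤-reflexive (sym (+-identityʳ _))))

-- The strict lower bound makes `ℓ / 1` one of the rationals to which `AtLeastNLog60` applies and
-- bounds path lengths; the upper bound controls `n * n`.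
log₂-bracket : ∀ n → 1 < n → ∃ λ ℓ → 2 ^ ℓ < n × n ≤ 2 ^ suc ℓ
log₂-bracket n 1<n = search n (<⇒≤ (n<2^n n))
  where
  search : ∀ b → n ≤ 2 ^ b → ∃ λ ℓ → 2 ^ ℓ < n × n ≤ 2 ^ suc ℓ
  search zero    n≤ = contradiction (<-≤-trans 1<n n≤) (<-irrefl refl)
  search (suc b) n≤ with <-≤-connex (2 ^ b) n
  ... | inj₁ lt = b , lt , n≤
  ... | inj₂ ge = search b ge

-- A rational `a / b` above `log₂ n` is above `ℓ` too, by monotonicity of powers of 2.
atMostLog6 : ∀ n ℓ t → 2 ^ ℓ < n → t ≤ ℓ ^ 6 → AtMostLog6 n t
atMostLog6 n ℓ t ℓ< t≤ a b b>0 lt = begin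
  t * b ^ 6           ≤⟨ *-monoˡ-≤ (b ^ 6) t≤ ⟩
  ℓ ^ 6 * b ^ 6       ≡⟨ ^-distribʳ-* ℓ b 6 ⟨
  (ℓ * b) ^ 6         ≤⟨ ^-monoˡ-≤ 6 ℓb≤a ⟩
  a ^ 6               ∎
  where
  open ≤-Reasoning
  ℓb≤a : ℓ * b ≤ a
  ℓb≤a = ≮⇒≥ λ a<ℓb → <-irrefl refl (begin-strict
    2 ^ a              ≤⟨ ^-monoʳ-≤ 2 (<⇒≤ a<ℓb) ⟩
    2 ^ (ℓ * b)        ≡⟨ ^-*-assoc 2 ℓ b ⟨
    (2 ^ ℓ) ^ b        ≤⟨ ^-monoˡ-≤ b (<⇒≤ ℓ<) ⟩
    n ^ b              <⟨ lt ⟩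
    2 ^ a              ∎)

module Parameters (m ℓ : ℕ) (m≤ℓ : m ≤ ℓ) (1000≤ℓ : 1000 ≤ ℓ) where

  instance
    ℓ≢0 : NonZero ℓ
    ℓ≢0 = >-nonZero (≤-trans (s≤s z≤n) 1000≤ℓ)

  -- ℓ is about log₂ n.  J exceeds log n² to base 3/2, and k rounds, each of growth
  -- factor 1 + 1 / X, multiply the volume by at least 2 ^ (4 * ℓ) > n².
  J′ r X k K B δ d : ℕ
  J′ = 8 * ℓ
  r  = 4 * suc J′
  X  = 2 * (2 * r)
  k  = X * (4 * ℓ)
  K  = k + k
  B  = m * m
  δ  = ℓ ^ 8
  d  = 4 * δ

  1≤ℓ : 1 ≤ ℓ
  1≤ℓ = ≤-trans (s≤s z≤n) 1000≤ℓ

  numeral : ∀ {a b} → {_ : T (a ≤ᵇ b)} → a ≤ b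
  numeral {a} {b} {p} = ≤ᵇ⇒≤ a b p

  absorb : ∀ c a b → c ≤ 1000 → a < b → c * ℓ ^ a ≤ ℓ ^ b
  absorb c a b c≤ a<b = ≤-trans (*-monoˡ-≤ (ℓ ^ a) (≤-trans c≤ 1000≤ℓ)) (^-monoʳ-≤ ℓ a<b)

  2r≤ : 2 * r ≤ 72 * ℓ
  2r≤ = begin
    2 * (4 * suc (8 * ℓ))     ≡⟨ arith ℓ ⟩
    8 * 1 + 64 * ℓ            ≤⟨ +-monoˡ-≤ (64 * ℓ) (*-monoʳ-≤ 8 1≤ℓ) ⟩
    8 * ℓ + 64 * ℓ            ≡⟨ *-distribʳ-+ ℓ 8 64 ⟨
    72 * ℓ                    ∎
    where
    open ≤-Reasoning
    arith : ∀ ℓ → 2 * (4 * suc (8 * ℓ)) ≡ 8 * 1 + 64 * ℓ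
    arith = solve-∀

  k≤ℓ³ : k ≤ ℓ ^ 3
  k≤ℓ³ = begin
    2 * (2 * r) * (4 * ℓ)       ≤⟨ *-monoˡ-≤ (4 * ℓ) (*-monoʳ-≤ 2 2r≤) ⟩
    2 * (72 * ℓ) * (4 * ℓ)      ≡⟨ arith ℓ ⟩
    576 * ℓ ^ 2                 ≤⟨ absorb 576 2 3 numeral numeral ⟩
    ℓ ^ 3                       ∎
    where
    open ≤-Reasoning
    arith : ∀ ℓ → 2 * (72 * ℓ) * (4 * ℓ) ≡ 576 * (ℓ * (ℓ * 1))
    arith = solve-∀

  k>0 : 0 < k
  k>0 = *-mono-≤ {1} {X} {1} {4 * ℓ} (s≤s z≤n) (≤-trans 1≤ℓ (m≤m+n ℓ _))

  6k[1+k]≤δ : 6 * k * suc k ≤ δ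
  6k[1+k]≤δ = begin
    6 * k * suc k                    ≤⟨ *-mono-≤ (*-monoʳ-≤ 6 k≤ℓ³) (s≤s k≤ℓ³) ⟩
    6 * ℓ ^ 3 * suc (ℓ ^ 3)          ≡⟨ arith (ℓ ^ 3) ⟩
    6 * (ℓ ^ 3 * ℓ ^ 3) + 6 * ℓ ^ 3  ≡⟨ cong (λ t → 6 * t + 6 * ℓ ^ 3) (^-distribˡ-+-* ℓ 3 3) ⟨
    6 * ℓ ^ 6 + 6 * ℓ ^ 3            ≤⟨ +-monoʳ-≤ (6 * ℓ ^ 6) (*-monoʳ-≤ 6 (^-monoʳ-≤ ℓ {3} {6} numeral)) ⟩
    6 * ℓ ^ 6 + 6 * ℓ ^ 6            ≡⟨ *-distribʳ-+ (ℓ ^ 6) 6 6 ⟨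
    12 * ℓ ^ 6                       ≤⟨ absorb 12 6 8 numeral numeral ⟩
    δ                                ∎
    where
    open ≤-Reasoning
    arith : ∀ q → 6 * q * suc q ≡ 6 * (q * q) + 6 * q
    arith = solve-∀

  -- The terms quadratic in `ℓ ^ 3` dominate, and the factor `2 * r` is of order `ℓ`. The outcome
  -- `936 * ℓ ^ 7` explains both `δ = ℓ ^ 8` and the threshold 1000.
  robust : ∀ {f z} → f ≤ m + B * K → z ≤ B * suc K → 2 * r * (f + z + k + 6 * k * k) ≤ δ
  robust {f} {z} f≤ z≤ = begin
    2 * r * (f + z + k + 6 * k * k)
      ≤⟨ *-mono-≤ 2r≤ (+-mono-≤ (+-mono-≤ (+-mono-≤ f≤′ z≤′) k≤ℓ³) (*-mono-≤ (*-monoʳ-≤ 6 k≤ℓ³) k≤ℓ³)) ⟩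
    72 * ℓ * ((q + q * (q + q)) + q * suc (q + q) + q + 6 * q * q)
      ≡⟨ cong (72 * ℓ *_) (arith₁ q) ⟩
    72 * ℓ * (3 * (1 * q) + 10 * (q * q))
      ≤⟨ *-monoʳ-≤ (72 * ℓ) (+-monoˡ-≤ (10 * (q * q)) (*-monoʳ-≤ 3 (*-monoˡ-≤ q (m^n>0 ℓ 3)))) ⟩
    72 * ℓ * (3 * (q * q) + 10 * (q * q))
      ≡⟨ arith₂ ℓ (q * q) ⟩
    936 * (ℓ * (q * q))
      ≡⟨ cong (λ t → 936 * (ℓ * t)) (^-distribˡ-+-* ℓ 3 3) ⟨
    936 * ℓ ^ 7
      ≤⟨ absorb 936 7 8 numeral numeral ⟩
    δ ∎
    where
    open ≤-Reasoning
    q = ℓ ^ 3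
    m≤q : m ≤ q
    m≤q = ≤-trans m≤ℓ (≤-trans (≤-reflexive (sym (*-identityʳ ℓ))) (^-monoʳ-≤ ℓ {1} {3} numeral))
    B≤q : B ≤ q
    B≤q = ≤-trans (*-mono-≤ m≤ℓ (≤-trans m≤ℓ (≤-reflexive (sym (*-identityʳ ℓ))))) (^-monoʳ-≤ ℓ {2} {3} numeral)
    f≤′ : f ≤ q + q * (q + q)
    f≤′ = ≤-trans f≤ (+-mono-≤ m≤q (*-mono-≤ B≤q (+-mono-≤ k≤ℓ³ k≤ℓ³)))
    z≤′ : z ≤ q * suc (q + q)
    z≤′ = ≤-trans z≤ (*-mono-≤ B≤q (s≤s (+-mono-≤ k≤ℓ³ k≤ℓ³)))
    arith₁ : ∀ q → (q + q * (q + q)) + q * suc (q + q) + q + 6 * q * q ≡ 3 * (1 * q) + 10 * (q * q)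
    arith₁ = solve-∀
    arith₂ : ∀ ℓ t → 72 * ℓ * (3 * t + 10 * t) ≡ 936 * (ℓ * t)
    arith₂ = solve-∀

  2≤d : 2 ≤ d
  2≤d = *-mono-≤ {2} {4} {1} numeral (m^n>0 ℓ 8)

  m≤δ : m ≤ δ
  m≤δ = ≤-trans m≤ℓ (≤-trans (≤-reflexive (sym (*-identityʳ ℓ))) (^-monoʳ-≤ ℓ {1} {8} numeral))

  K≤ℓ⁶ : K ≤ ℓ ^ 6
  K≤ℓ⁶ = begin
    k + k           ≡⟨ cong (k +_) (+-identityʳ k) ⟨
    2 * k           ≤⟨ *-monoʳ-≤ 2 k≤ℓ³ ⟩
    2 * ℓ ^ 3       ≤⟨ absorb 2 3 6 numeral numeral ⟩
    ℓ ^ 6           ∎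
    where open ≤-Reasoning

  n²<16^ℓ : ∀ {n} → n ≤ 2 ^ suc ℓ → n * n < 16 ^ ℓ
  n²<16^ℓ {n} n≤ = begin-strict
    n * n                          ≤⟨ *-mono-≤ n≤ n≤ ⟩
    2 * 2 ^ ℓ * (2 * 2 ^ ℓ)        ≡⟨ arith (2 ^ ℓ) ⟩
    4 * (2 ^ ℓ * 2 ^ ℓ)            ≤⟨ *-monoˡ-≤ _ (≤-trans (≤-trans (numeral {4} {1000}) 1000≤ℓ) (<⇒≤ (n<2^n ℓ))) ⟩
    2 ^ ℓ * (2 ^ ℓ * 2 ^ ℓ)        ≡⟨ cong (2 ^ ℓ *_) (^-distribʳ-* 2 2 ℓ) ⟨
    2 ^ ℓ * 4 ^ ℓ                  ≡⟨ ^-distribʳ-* 2 4 ℓ ⟨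
    8 ^ ℓ                          <⟨ ^-monoˡ-< ℓ {8} {16} numeral ⟩
    16 ^ ℓ                         ∎
    where
    open ≤-Reasoning
    arith : ∀ p → 2 * p * (2 * p) ≡ 4 * (p * p)
    arith = solve-∀

  deep : ∀ {n t} → n ≤ 2 ^ suc ℓ → t ≤ n * n → t * X ^ k < (X + 1) ^ k
  deep n≤ t≤ = deepEnough X (4 * ℓ) (≤-<-trans t≤ (<-≤-trans (n²<16^ℓ n≤) (≤-reflexive (^-*-assoc 2 4 ℓ))))

  -- The 8 in `J′` comes from `2 ^ 8 * 16 = 4096 ≤ 6561 = 3 ^ 8`.
  small : ∀ {n D} → n ≤ 2 ^ suc ℓ → D ≤ n * n → 2 ^ suc J′ * D ≤ 3 ^ suc J′
  small {n} {D} n≤ D≤ = begin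
    2 * 2 ^ (8 * ℓ) * D            ≤⟨ *-mono-≤ (*-monoˡ-≤ (2 ^ (8 * ℓ)) {2} {3} numeral) (≤-trans D≤ (<⇒≤ (n²<16^ℓ n≤))) ⟩
    3 * 2 ^ (8 * ℓ) * 16 ^ ℓ       ≡⟨ *-assoc 3 (2 ^ (8 * ℓ)) (16 ^ ℓ) ⟩
    3 * (2 ^ (8 * ℓ) * 16 ^ ℓ)     ≡⟨ cong (λ t → 3 * (t * 16 ^ ℓ)) (^-*-assoc 2 8 ℓ) ⟨
    3 * (256 ^ ℓ * 16 ^ ℓ)         ≡⟨ cong (3 *_) (^-distribʳ-* 256 16 ℓ) ⟨
    3 * 4096 ^ ℓ                   ≤⟨ *-monoʳ-≤ 3 (^-monoˡ-≤ ℓ {4096} {6561} numeral) ⟩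
    3 * 6561 ^ ℓ                   ≡⟨ cong (3 *_) (^-*-assoc 3 8 ℓ) ⟩
    3 * 3 ^ (8 * ℓ)                ∎
    where open ≤-Reasoning

-- Assembling the subdivision in a large graph

module LargeGraph (m n ℓ : ℕ) (m≤ℓ : m ≤ ℓ) (1000≤ℓ : 1000 ≤ ℓ) (2^ℓ<n : 2 ^ ℓ < n) (n≤2^1+ℓ : n ≤ 2 ^ suc ℓ)
  (G : Graph n) (c : Colouring n) (proper : IsProperColouring G c) (many : AtLeastNLog60 n (numEdges G)) where

  open Parameters m ℓ m≤ℓ 1000≤ℓ
  open Extraction (adj G) (adj-symm G) J′ d δ 2≤d (≤-refl {4 * δ})

  instance
    n≢0 : NonZero n
    n≢0 = >-nonZero (≤-<-trans z≤n 2^ℓ<n)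

  everything : Fin n → Bool
  everything _ = true

  D≤n² : ∀ H → D H ≤ n * n
  D≤n² H = begin
    ∑ (λ x → ∑ λ y → ⟦ induced H x y ⟧)  ≤⟨ ∑-mono (λ x → ∑-mono λ y → ⟦⟧≤1 (induced H x y)) ⟩
    ∑ {n} (λ x → ∑ {n} λ y → 1)          ≡⟨ ∑-cong (λ x → trans (∑-const n 1) (*-identityʳ n)) ⟩
    ∑ {n} (λ x → n)                      ≡⟨ ∑-const n n ⟩
    n * n                                ∎
    where open ≤-Reasoning

  numEdges≤D : numEdges G ≤ D everything
  numEdges≤D = ≤-trans (≤-reflexive (length-filter-cartesianProduct _ id id)) (∑-mono λ x → ∑-mono λ y → pointwise x y)
    where
    boolean : ∀ a b → ⟦ a ∧ b ⟧ ≤ ⟦ b ⟧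
    boolean true  b = ≤-refl
    boolean false b = z≤n
    pointwise : ∀ x y → ⟦ does ((toℕ x <? toℕ y) ×-dec T? (adj G x y)) ⟧ ≤ ⟦ induced everything x y ⟧
    pointwise x y = boolean (does (toℕ x <? toℕ y)) (adj G x y)

  dn<D : d * n < D everything
  dn<D = begin-strict
    4 * ℓ ^ 8 * n            <⟨ *-monoˡ-< n {4 * ℓ ^ 8} {5 * ℓ ^ 8} (*-monoˡ-< (ℓ ^ 8) {{m^n≢0 ℓ 8}} (n<1+n 4)) ⟩
    5 * ℓ ^ 8 * n            ≤⟨ *-monoˡ-≤ n (absorb 5 8 60 numeral numeral) ⟩
    ℓ ^ 60 * n               ≤⟨ many ℓ 1 z<s (<-≤-trans 2^ℓ<n (≤-reflexive (sym (*-identityʳ n)))) ⟩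
    numEdges G * 1           ≡⟨ *-identityʳ (numEdges G) ⟩
    numEdges G               ≤⟨ numEdges≤D ⟩
    D everything             ∎
    where open ≤-Reasoning

  initially : Dense (suc J′) everything
  initially = record { level = ≤-refl ; dense = dense ; small = small n≤2^1+ℓ (D≤n² everything) }
    where
    open ≤-Reasoning
    arith : ∀ d j n → d * (j + j) * n ≡ 2 * j * (d * n)
    arith = solve-∀
    dense : d * (suc J′ + suc J′) * size everything < 2 * suc J′ * D everything
    dense = begin-strict
      d * (suc J′ + suc J′) * size everything  ≡⟨ cong (d * (suc J′ + suc J′) *_) (trans (∑-const n 1) (*-identityʳ n)) ⟩
      d * (suc J′ + suc J′) * n                ≡⟨ arith d (suc J′) n ⟩
      2 * suc J′ * (d * n)                     <⟨ *-monoʳ-< (2 * suc J′) dn<D ⟩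
      2 * suc J′ * D everything                ∎

  module InExpander (H : Fin n → Bool) (ex : Expander (induced H) r δ) where
    E : Fin n → Fin n → Bool
    E = induced H

    E⇒Adj : ∀ {x y} → E x y ≡ true → Adj G x y
    E⇒Adj {x} {y} e = Equivalence.from T-≡ (proj₂ (∧-true {H x ∧ H y} e))

    pr : ProperOn E c
    pr = record
      { symm     = induced-sym H
      ; c-symm   = λ x y e → proj₁ proper x y (E⇒Adj e)
      ; c-proper = c-proper }
      where
      c-proper : ∀ x y z → E x y ≡ true → E x z ≡ true → c x y ≡ c x z → y ≡ z
      c-proper x y z e f eq with y Fin.≟ z
      ... | yes y≡z = y≡z
      ... | no y≢z  = contradiction eq (proj₂ proper x y z (E⇒Adj e) (E⇒Adj f) y≢z)

    C : ℕ
    C = suc (∑ λ x → ∑ (c x))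

    c<C : ∀ x y → c x y < C
    c<C x y = s≤s (≤-trans (term≤∑ (c x) y) (term≤∑ (λ x → ∑ (c x)) x))

    center : ∃ λ x → 0 < deg E x
    center = ∑-pos (Expander.nonempty ex)

    -- The neighbours of a non-isolated vertex supply the branch vertices: there are at least
    -- `δ ≥ m` of them, and each has positive degree, so a ball can grow from it.
    choice : ∃ λ (f : Fin m → Fin n) → (∀ i j → f i ≡ f j → i ≡ j) × (∀ i → E (proj₁ center) (f i) ≡ true)
    choice = choose (E (proj₁ center)) m (≤-trans m≤δ (Expander.minDeg ex _ (proj₂ center)))

    branch : Fin m → Fin n
    branch = proj₁ choice

    branch-deg : ∀ {v} → (∃ λ i → v ≡ branch i) → 0 < deg E v
    branch-deg (i , refl) = edge⇒deg E (branch i) (proj₁ center)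
      (trans (induced-sym H (branch i) (proj₁ center)) (proj₂ (proj₂ choice) i))

    connect : ∀ F Z u v → length F ≤ m + B * K → length Z ≤ B * suc K →
      u ≢ v → u ∈ F → v ∈ F → (∃ λ i → u ≡ branch i) → (∃ λ i → v ≡ branch i) → ∃ (Link E c pr F Z u v K)
    connect F Z u v F≤ Z≤ u≢v u∈F v∈F u-branch v-branch =
      Connection.connection E c pr r δ ex C c<C k k>0 6k[1+k]≤δ F Z (robust F≤ Z≤)
        (deep n≤2^1+ℓ (D≤n² H)) u v u≢v u∈F v∈F (branch-deg u-branch) (branch-deg v-branch)

    open Routing E c pr branch (proj₁ (proj₂ choice)) K B connect

    pairs≤ : length (ordPairs m) ≤ B
    pairs≤ = begin
      length (ordPairs m)                                     ≡⟨ length-filter-cartesianProduct (λ p → toℕ (proj₁ p) <? toℕ (proj₂ p)) id id ⟩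
      ∑ {m} (λ i → ∑ {m} λ j → ⟦ does (toℕ i <? toℕ j) ⟧)     ≤⟨ ∑-mono (λ i → ∑-mono λ j → ⟦⟧≤1 (does (toℕ i <? toℕ j))) ⟩
      ∑ {m} (λ i → ∑ {m} λ j → 1)                             ≡⟨ ∑-cong (λ i → trans (∑-const m 1) (*-identityʳ m)) ⟩
      ∑ {m} (λ i → m)                                         ≡⟨ ∑-const m m ⟩
      m * m                                                   ∎
      where open ≤-Reasoning

    routes : Routes (ordPairs m)
    routes = route (ordPairs m) pairs≤
      (Unique.filter⁺ _ (Unique.cartesianProduct⁺ (Unique.allFin⁺ m) (Unique.allFin⁺ m)))
      (All.map (λ lt eq → <-irrefl (cong toℕ eq) lt)
        (All.all-filter (λ p → toℕ (proj₁ p) <? toℕ (proj₂ p)) (cartesianProduct (allFin m) (allFin m))))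

    subdivision : RainbowSubdivision m G c
    subdivision = record
      { branch   = branch
      ; path     = λ i j → Routes.path routes (i , j)
      ; isPath   = All.map (Linked.map E⇒Adj) (Routes.linked routes)
      ; short    = All.map (λ {p} len → atMostLog6 n ℓ (length (Routes.path routes p)) 2^ℓ<n (≤-trans len K≤ℓ⁶)) (Routes.short routes)
      ; disjoint = Routes.disjoint routes
      ; rainbow  = Routes.rainbow routes }

  subdivision : RainbowSubdivision m G c
  subdivision = let H , ex = extract (suc J′) (size everything) everything ≤-refl initially in InExpander.subdivision H ex

theorem2 : (m : ℕ) → 2 ≤ m →
    Σ ℕ (λ N → (n : ℕ) → N ≤ n → (G : Graph n) → (c : Colouring n) →
    IsProperColouring G c → AtLeastNLog60 n (numEdges G) →
    RainbowSubdivision m G c)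
-- From `2 ^ suc (m + 1000) ≤ n ≤ 2 ^ suc ℓ` both `m ≤ ℓ` and `1000 ≤ ℓ` follow.
theorem2 m _ = 2 ^ suc (m + 1000) , λ n N≤n G c proper many →
  let ℓ , 2^ℓ<n , n≤2^1+ℓ = log₂-bracket n (1<n N≤n)
      m+1000≤ℓ = large N≤n n≤2^1+ℓ
  in LargeGraph.subdivision m n ℓ (m+n≤o⇒m≤o m m+1000≤ℓ) (m+n≤o⇒n≤o m m+1000≤ℓ) 2^ℓ<n n≤2^1+ℓ G c proper many
  where
  1<n : ∀ {n} → 2 ^ suc (m + 1000) ≤ n → 1 < n
  1<n = ≤-trans (*-monoʳ-≤ 2 (m^n>0 2 (m + 1000)))
  large : ∀ {n ℓ} → 2 ^ suc (m + 1000) ≤ n → n ≤ 2 ^ suc ℓ → m + 1000 ≤ ℓ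
  large N≤n n≤ = ≮⇒≥ λ ℓ<m+1000 → <-irrefl refl
    (<-≤-trans (^-monoʳ-< 2 (n<1+n 1) (n<1+n (m + 1000))) (≤-trans N≤n (≤-trans n≤ (^-monoʳ-≤ 2 ℓ<m+1000))))
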